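{- Let $E$ be a finite set, $p \in (0,1)$, and let $k$ be a positive integer. For any integer $h \ge 1$, any $k$-exchange system $\mathcal{D} \subseteq 2^E$ admits an $(\alpha_h,\beta_h)$-uniform exchange map, where \[ \alpha_h = \frac{p^h}{h}, \qquad \beta_h = \frac{p^h}{h}\cdot\left(k - 1 + \frac1h\right). \]
   Context: A hereditary (closed under taking subsets) set system $\mathcal{D} \subseteq 2^E$ is a $k$-exchange system if for every $X, Y \in \mathcal{D}$ there is a collection of subsets $\{T_y\}_{y \in Y \setminus X}$ of $X \setminus Y$ such that (1) $|T_y| \le k$ for each $y$; (2) each $x \in X \setminus Y$ appears at most $k$ times in the collection; (3) for every $S \subseteq Y \setminus X$, $(X \cup S) \setminus \bigcup_{y \in S} T_y \in \mathcal{D}$. Exchange maps: for $X, Y \in \mathcal{D}$, an exchange map between $X$ and $Y$ is a pair of (possibly random) functions $S_{X,Y} \colon 2^{Y \setminus X} \to 2^{Y \setminus X}$ and $T_{X,Y} \colon 2^{Y \setminus X} \to 2^{X \setminus Y}$ such that for every $R \subseteq Y \setminus X$: (1) $S_{X,Y}(R) \subseteq R$, and (2) $(X \cup S_{X,Y}(R)) \setminus T_{X,Y}(R) \in \mathcal{D}$. It is $(\alpha,\beta)$-uniform if $\Pr(y \in S_{X,Y}(R)) \ge \alpha$ for all $y \in Y \setminus X$ and $\Pr(x \in T_{X,Y}(R)) \le \beta$ for all $x \in X \setminus Y$, where the probability is over the random set $R \subseteq Y \setminus X$ containing each $y \in Y\setminus X$ independently with probability $p$ (and any internal randomness of the map).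 $\mathcal{D}$ admits an $(\alpha,\beta)$-uniform exchange map if there is an $(\alpha,\beta)$-uniform exchange map between $X$ and $Y$ for all $X, Y \in \mathcal{D}$.
   Formalization: The case k = 1 with h ≥ 2 is excluded, since the claim is false there: for D = {∅,{x},{y}}, X = {x}, Y = {y}, y ∈ S(R) forces x ∈ T(R), so Pr(x ∈ T) ≥ p^h/h > β_h = p^h/h². -}

module Defs where

open import Level using (_⊔_) renaming (suc to lsuc)
open import Algebra.Apartness.Bundles using (HeytingField)
open import Algebra.Bundles using (CommutativeRing; Semiring)
import Algebra.Definitions.RawSemiring as RawSemiringDefs
open import Data.Bool.Base using (if_then_else_)
open import Data.Fin.Base using (Fin)
open import Data.Fin.Subset using (Subset; _∈_; _⊆_; _∪_; _─_; ⋃; ∣_∣; inside; outside)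
open import Data.Fin.Subset.Properties using (_∈?_)
open import Data.List.Base using (List; [_]; _++_; map; filter; foldr; length; allFin)
open import Data.Nat.Base as ℕ using (ℕ; zero; suc; NonZero)
open import Data.Product.Base using (Σ; proj₁)
open import Data.Sum.Base using (_⊎_; inj₂)
import Data.Vec.Base as Vec
open import Function.Bundles using (_⇔_; Equivalence)
open import Relation.Binary.Core using (Rel)
open import Relation.Binary.Structures using (IsStrictPartialOrder)
open import Relation.Nullary.Decidable.Core using (does)
open import Relation.Nullary.Negation.Core using (¬_)
open import Relation.Unary using (Pred)

------------------------------------------------------------------------
-- Ordered fields

-- The library has no real numbers, so probabilities live in an arbitrary
-- ordered field.  Neither decidability nor totality of the order is
-- required, so that constructive real numbers are an instance, as are ℚ
-- and the classical reals.
record OrderedField c ℓ₁ ℓ₂ : Set (lsuc (c ⊔ ℓ₁ ⊔ ℓ₂)) where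
  field
    heytingField : HeytingField c ℓ₁ ℓ₂

  open HeytingField heytingField public

  infix 4 _<_ _≤_
  field
    _<_                  : Rel Carrier ℓ₂
    isStrictPartialOrder : IsStrictPartialOrder _≈_ _<_
    #⇔<⊎>                : ∀ {x y} → (x # y) ⇔ (x < y ⊎ y < x)
    0<1                  : 0# < 1#
    +-monoʳ-<            : ∀ z {x y} → x < y → z + x < z + y
    *-pos                : ∀ {x y} → 0# < x → 0# < y → 0# < x * y

  module < = IsStrictPartialOrder isStrictPartialOrder

  _≤_ : Rel Carrier ℓ₂
  x ≤ y = ¬ (y < x)

  commutativeRing : CommutativeRing c ℓ₁
  commutativeRing = record { isCommutativeRing = isCommutativeRing }

  open RawSemiringDefs (Semiring.rawSemiring (CommutativeRing.semiring commutativeRing)) public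
    using (_^_) renaming (_×_ to _×ℕ_)

  fromℕ : ℕ → Carrier
  fromℕ n = n ×ℕ 1#

  0<fromℕ-suc : ∀ n → 0# < fromℕ (suc n)
  0<fromℕ-suc zero    = <.<-respʳ-≈ (sym (+-identityʳ 1#)) 0<1
  0<fromℕ-suc (suc n) =
    <.trans 0<1 (<.<-respˡ-≈ (+-identityʳ 1#) (+-monoʳ-< 1# (0<fromℕ-suc n)))

  fromℕ#0 : ∀ n .{{_ : NonZero n}} → fromℕ n # 0#
  fromℕ#0 (suc n) = Equivalence.from #⇔<⊎> (inj₂ (0<fromℕ-suc n))

  -- The library's #⇒invertible yields an inverse of fromℕ n - 0#.
  infixl 7 _/ℕ_
  _/ℕ_ : Carrier → (n : ℕ) .{{_ : NonZero n}} → Carrier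
  x /ℕ n = x * proj₁ (#⇒invertible (fromℕ#0 n))

  ∑ : ∀ {a} {A : Set a} → List A → (A → Carrier) → Carrier
  ∑ xs f = foldr _+_ 0# (map f xs)

------------------------------------------------------------------------
-- Set systems on the ground set Fin n

elements : ∀ {n} → Subset n → List (Fin n)
elements {n} A = filter (_∈? A) (allFin n)

subsets : ∀ {n} → Subset n → List (Subset n)
subsets Vec.[]              = [ Vec.[] ]
subsets (outside Vec.∷ A) = map (outside Vec.∷_) (subsets A)
subsets (inside  Vec.∷ A) =
  map (inside Vec.∷_) (subsets A) ++ map (outside Vec.∷_) (subsets A)

Hereditary : ∀ {n ℓ} → Pred (Subset n) ℓ → Set ℓ
Hereditary D = ∀ {A B} → A ⊆ B → D B → D A

-- T is only constrained on Y ─ X, so it stands for a family indexed by Y ─ X.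
record ExchangeFamily {n ℓ} (k : ℕ) (D : Pred (Subset n) ℓ) (X Y : Subset n) : Set ℓ where
  field
    T            : Fin n → Subset n
    T⊆X─Y        : ∀ {y} → y ∈ Y ─ X → T y ⊆ X ─ Y
    size≤k       : ∀ {y} → y ∈ Y ─ X → ∣ T y ∣ ℕ.≤ k
    occurrence≤k : ∀ {x} → x ∈ X ─ Y →
                   length (filter (λ y → x ∈? T y) (elements (Y ─ X))) ℕ.≤ k
    exchange     : ∀ S → S ⊆ Y ─ X → D ((X ∪ S) ─ ⋃ (map T (elements S)))

record IsExchangeSystem {n ℓ} (k : ℕ) (D : Pred (Subset n) ℓ) : Set ℓ where
  field
    hereditary     : Hereditary D
    exchangeFamily : ∀ {X Y} → D X → D Y → ExchangeFamily k D X Y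

------------------------------------------------------------------------
-- Random exchange maps

module _ {c ℓ₁ ℓ₂} (F : OrderedField c ℓ₁ ℓ₂) where
  open OrderedField F

  record FiniteProbabilitySpace : Set (c ⊔ ℓ₁ ⊔ ℓ₂) where
    field
      size     : ℕ
      prob     : Fin size → Carrier
      prob≥0   : ∀ ω → 0# ≤ prob ω
      ∑-prob≈1 : ∑ (allFin size) prob ≈ 1#

    Outcome : Set
    Outcome = Fin size

  -- The internal randomness is a finite space: there are only finitely many
  -- pairs of maps between power sets of finite sets, so a random pair is a
  -- finite distribution.  S and T are only constrained on subsets of Y ─ X.
  record ExchangeMap {n ℓ} (D : Pred (Subset n) ℓ) (X Y : Subset n)
                     : Set (c ⊔ ℓ₁ ⊔ ℓ₂ ⊔ ℓ) where
    field
      space : FiniteProbabilitySpace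

    open FiniteProbabilitySpace space public

    field
      S T      : Outcome → Subset n → Subset n
      S⊆R      : ∀ ω {R} → R ⊆ Y ─ X → S ω R ⊆ R
      T⊆X─Y    : ∀ ω {R} → R ⊆ Y ─ X → T ω R ⊆ X ─ Y
      feasible : ∀ ω {R} → R ⊆ Y ─ X → D ((X ∪ S ω R) ─ T ω R)

  -- The probability that R is the random subset of A that contains each
  -- element of A independently with probability p.
  subsetProb : ∀ {n} → Carrier → Subset n → Subset n → Carrier
  subsetProb p A R = p ^ ∣ R ∣ * (1# - p) ^ ∣ A ─ R ∣

  -- The probability of z ∈ M ω R, for ω from the space Ω and, independently
  -- of ω, R a p-random subset of A.
  Pr∈ : ∀ {n} (Ω : FiniteProbabilitySpace) → Carrier → Subset n →
        (FiniteProbabilitySpace.Outcome Ω → Subset n → Subset n) → Fin n → Carrier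
  Pr∈ Ω p A M z =
    ∑ (allFin size) λ ω → ∑ (subsets A) λ R →
      prob ω * subsetProb p A R * (if does (z ∈? M ω R) then 1# else 0#)
    where open FiniteProbabilitySpace Ω

  record IsUniform {n ℓ} {D : Pred (Subset n) ℓ} {X Y : Subset n}
                   (p α β : Carrier) (M : ExchangeMap D X Y) : Set ℓ₂ where
    open ExchangeMap M
    field
      Pr∈S≥α : ∀ {y} → y ∈ Y ─ X → α ≤ Pr∈ space p (Y ─ X) S y
      Pr∈T≤β : ∀ {x} → x ∈ X ─ Y → Pr∈ space p (Y ─ X) T x ≤ β

  AdmitsUniformExchangeMap : ∀ {n ℓ} → Carrier → Carrier → Carrier →
                             Pred (Subset n) ℓ → Set (c ⊔ ℓ₁ ⊔ ℓ₂ ⊔ ℓ)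
  AdmitsUniformExchangeMap p α β D =
    ∀ {X Y} → D X → D Y → Σ (ExchangeMap D X Y) (IsUniform p α β)

{-# OPTIONS --safe #-}
-- Write A = Y ∖ X.  With T(R) the union of the T_y for y ∈ S(R), every S(R) ⊆ R is feasible,
-- and if Pr(y ∈ S(R)) = α for all y ∈ A then Pr(x ∈ T(R)) ≤ d α for x in d ≤ k of the sets T_y.
-- So only elements x with d = k matter, and for them it suffices to find y₁ ≠ y₂ with
-- x ∈ T_y₁ ∩ T_y₂ and Pr(y₂ ∈ S(R), y₁ ∉ S(R)) ≤ α / h.
--
-- The incidence graph of X ∖ Y and A has maximum degree k.  Loops turn it into a k-regular
-- matrix, and two disjoint transversals π₁, π₂ of it (Hall's theorem, twice) give a permutation
-- σ = π₂ ∘ π₁⁻¹ such that y₁ = π₁ x and y₂ = σ y₁ work as follows.  Colour the elements with h²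
-- colours so that any h consecutive ones of a σ-orbit are distinct, and pick a colour c uniformly.
-- Put y into S(R) if one of y, σ⁻¹ y, …, σ¹⁻ʰ y has colour c and, calling it z, the segment
-- {z, σ z, …, σʰ⁻¹ z} ∩ A lies in R and an independent event makes the total probability exactly
-- pʰ.  Each y has h such segments, so α = h pʰ / h², and y and σ y share all but one of them.
-- On orbits shorter than h the segments are replaced by h copies of the whole orbit.
module Submission where

open import Defs
open import Algebra.Bundles using (CommutativeRing)
import Algebra.Properties.Ring
import Algebra.Properties.Semiring.Exp
import Algebra.Properties.Semiring.Mult
import Algebra.Properties.Semiring.Sum
import Algebra.Solver.CommutativeMonoid
open import Data.Bool.Base using (Bool; true; false; if_then_else_; _∧_)
open import Data.Empty using (⊥-elim)
open import Data.Fin.Base using (Fin; zero; suc; toℕ; fromℕ<; inject≤; inject₁; punchOut)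
open import Data.Fin.Permutation using (Permutation′; permutation; _⟨$⟩ʳ_; _⟨$⟩ˡ_; inverseˡ; inverseʳ) renaming (id to idₚ)
import Data.Fin.Properties as Fin
open import Data.Fin.Subset using (Subset; _∈_; _∉_; _⊆_; _∪_; _∩_; _─_; ⋃; ⁅_⁆; ∣_∣; inside; outside) renaming (⊥ to ∅)
open import Data.Fin.Subset.Properties
open import Data.List.Base as List using (List; []; _∷_; _++_; map; filter; length; allFin; applyUpTo; cartesianProduct)
import Data.List.Membership.DecPropositional as DecMembership
open import Data.List.Membership.Propositional using (lose) renaming (_∈_ to _∈ˡ_; _∉_ to _∉ˡ_)
open import Data.List.Membership.Propositional.Properties using (∈-allFin; ∈-map⁺; ∈-++⁺ˡ; ∈-++⁺ʳ; ∈-++⁻; ∈-applyUpTo⁺; ∈-applyUpTo⁻; ∈-filter⁺; ∈-filter⁻; ∈-cartesianProduct⁻; ∈-lookup)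
open import Data.List.Properties using (length-map; length-++; length-applyUpTo; length-tabulate; map-∘; map-tabulate; tabulate-lookup; filter-notAll)
open import Data.List.Relation.Unary.All as All using (All; []; _∷_)
import Data.List.Relation.Unary.All.Properties as All
open import Data.List.Relation.Unary.Any using (here; there; index)
open import Data.List.Relation.Unary.Any.Properties using (lookup-index)
open import Data.Nat.Base as ℕ using (ℕ; zero; suc; z≤n; s≤s; s≤s⁻¹; NonZero)
open import Data.Nat.GeneralisedArithmetic using (fold; fold-+)
import Data.Nat.Properties as ℕ
open import Data.Product.Base using (Σ; ∃; ∃₂; _×_; _,_; proj₁; proj₂)
open import Data.Sum.Base using (_⊎_; inj₁; inj₂)
import Data.Vec.Base as Vec
open import Data.Vec.Properties using (lookup∘tabulate; lookup⇒[]=; []=⇒lookup)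
open import Function.Base using (_∘_; id)
open import Function.Bundles using (Equivalence)
open import Function.Definitions using (Injective)
open import Relation.Binary.Bundles using (Preorder)
open import Relation.Binary.Definitions using (tri<; tri≈; tri>)
import Relation.Binary.PropositionalEquality as ≡
import Relation.Binary.Reasoning.Preorder
import Relation.Binary.Reasoning.Setoid
open ≡ using (_≡_; _≢_)
open import Relation.Nullary
open import Relation.Nullary.Decidable using (_×-dec_; ¬?; dec-true; dec-false; decidable-stable)
open import Relation.Unary using (Pred; Decidable)

-- Finite combinatorics: matchings, colourings and orbits.

module Combinatorics where

  open import Data.Fin.Subset using (_-_)
  open import Data.Nat.Base using (_+_; _*_; _∸_; _≤_; _<_)
  open import Data.Nat.Properties hiding (_≟_)
  open ≡

  module Sum = Algebra.Properties.Semiring.Sum +-*-semiring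
  open Sum using (sum)

  private variable
    n m k : ℕ

  -- Subsets

  module _ {p} {P : Pred (Fin n) p} (P? : Decidable P) where

    select : Subset n
    select = Vec.tabulate (does ∘ P?)

    ∈-select⁺ : ∀ {i} → P i → i ∈ select
    ∈-select⁺ {i} pi = lookup⇒[]= i select (trans (lookup∘tabulate _ i) (dec-true (P? i) pi))

    ∈-select⁻ : ∀ {i} → i ∈ select → P i
    ∈-select⁻ {i} i∈ with P? i | trans (sym (lookup∘tabulate (does ∘ P?) i)) ([]=⇒lookup i∈)
    ... | yes pi | _ = pi
    ... | no _   | ()

  ∣p∪q∣+∣p∩q∣≡∣p∣+∣q∣ : (p q : Subset n) → ∣ p ∪ q ∣ + ∣ p ∩ q ∣ ≡ ∣ p ∣ + ∣ q ∣
  ∣p∪q∣+∣p∩q∣≡∣p∣+∣q∣ Vec.[] Vec.[] = refl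
  ∣p∪q∣+∣p∩q∣≡∣p∣+∣q∣ (outside Vec.∷ p) (outside Vec.∷ q) = ∣p∪q∣+∣p∩q∣≡∣p∣+∣q∣ p q
  ∣p∪q∣+∣p∩q∣≡∣p∣+∣q∣ (outside Vec.∷ p) (inside  Vec.∷ q) =
    trans (cong suc (∣p∪q∣+∣p∩q∣≡∣p∣+∣q∣ p q)) (sym (+-suc ∣ p ∣ ∣ q ∣))
  ∣p∪q∣+∣p∩q∣≡∣p∣+∣q∣ (inside  Vec.∷ p) (outside Vec.∷ q) = cong suc (∣p∪q∣+∣p∩q∣≡∣p∣+∣q∣ p q)
  ∣p∪q∣+∣p∩q∣≡∣p∣+∣q∣ (inside  Vec.∷ p) (inside  Vec.∷ q) = cong suc
    (trans (+-suc ∣ p ∪ q ∣ ∣ p ∩ q ∣) (trans (cong suc (∣p∪q∣+∣p∩q∣≡∣p∣+∣q∣ p q)) (sym (+-suc ∣ p ∣ ∣ q ∣))))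

  x∈p─q⇒x∉q : (p q : Subset n) {x : Fin n} → x ∈ p ─ q → x ∉ q
  x∈p─q⇒x∉q (_ Vec.∷ p) (inside Vec.∷ q)  (Vec.there x∈) (Vec.there x∈q) = x∈p─q⇒x∉q p q x∈ x∈q
  x∈p─q⇒x∉q (_ Vec.∷ p) (outside Vec.∷ q) (Vec.there x∈) (Vec.there x∈q) = x∈p─q⇒x∉q p q x∈ x∈q

  ∣p∣≤1+∣p-x∣ : (p : Subset n) (x : Fin n) → ∣ p ∣ ≤ suc ∣ p - x ∣
  ∣p∣≤1+∣p-x∣ p x = begin
    ∣ p ∣                                             ≤⟨ p⊆q⇒∣p∣≤∣q∣ p⊆ ⟩
    ∣ ⁅ x ⁆ ∪ (p - x) ∣                               ≤⟨ m≤m+n _ _ ⟩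
    ∣ ⁅ x ⁆ ∪ (p - x) ∣ + ∣ ⁅ x ⁆ ∩ (p - x) ∣         ≡⟨ ∣p∪q∣+∣p∩q∣≡∣p∣+∣q∣ ⁅ x ⁆ (p - x) ⟩
    ∣ ⁅ x ⁆ ∣ + ∣ p - x ∣                             ≡⟨ cong (_+ ∣ p - x ∣) (∣⁅x⁆∣≡1 x) ⟩
    suc ∣ p - x ∣                                     ∎
    where
    open ≤-Reasoning
    p⊆ : p ⊆ ⁅ x ⁆ ∪ (p - x)
    p⊆ {y} y∈p with y Fin.≟ x
    ... | yes refl = x∈p∪q⁺ (inj₁ (x∈⁅x⁆ x))
    ... | no y≢x   = x∈p∪q⁺ (inj₂ (x∈p∧x≢y⇒x∈p-y y∈p y≢x))

  -- Hall's marriage theorem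

  adjacent? : (G : Fin n → Subset m) (S : Subset n) → Decidable λ y → ∃ λ x → x ∈ S × y ∈ G x
  adjacent? G S y = Fin.any? λ x → (x ∈? S) ×-dec (y ∈? G x)

  neighbours : (Fin n → Subset m) → Subset n → Subset m
  neighbours G S = select (adjacent? G S)

  module _ {G : Fin n → Subset m} {S : Subset n} where

    ∈-neighbours⁺ : ∀ {x y} → x ∈ S → y ∈ G x → y ∈ neighbours G S
    ∈-neighbours⁺ {x} x∈S y∈Gx = ∈-select⁺ (adjacent? G S) (x , x∈S , y∈Gx)

    ∈-neighbours⁻ : ∀ {y} → y ∈ neighbours G S → ∃ λ x → x ∈ S × y ∈ G x
    ∈-neighbours⁻ = ∈-select⁻ (adjacent? G S)

  Hall : (Fin n → Subset m) → Set
  Hall G = ∀ S → ∣ S ∣ ≤ ∣ neighbours G S ∣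

  Hall? : (G : Fin n → Subset m) → Hall G ⊎ ∃ λ S → ∣ neighbours G S ∣ < ∣ S ∣
  Hall? G with anySubset? (λ S → suc ∣ neighbours G S ∣ ≤? ∣ S ∣)
  ... | yes bad = inj₂ bad
  ... | no ¬bad = inj₁ λ S → ≮⇒≥ λ lt → ¬bad (S , lt)

  delete : (Fin n → Subset m) → Fin n → Fin m → Fin n → Subset m
  delete G x y z with z Fin.≟ x
  ... | yes _ = G z - y
  ... | no  _ = G z

  module _ (G : Fin n → Subset m) (x : Fin n) (y : Fin m) where

    delete⊆ : ∀ z → delete G x y z ⊆ G z
    delete⊆ z with z Fin.≟ x
    ... | yes _ = p─q⊆p (G z) ⁅ y ⁆
    ... | no  _ = id

    ∈-delete⁺ : ∀ {z w} → w ∈ G z → z ≢ x ⊎ w ≢ y → w ∈ delete G x y z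
    ∈-delete⁺ {z} w∈ ne with z Fin.≟ x | ne
    ... | yes refl | inj₁ z≢x = ⊥-elim (z≢x refl)
    ... | yes refl | inj₂ w≢y = x∈p∧x≢y⇒x∈p-y w∈ w≢y
    ... | no _     | _        = w∈

    delete-shrinks : y ∈ G x → ∣ delete G x y x ∣ < ∣ G x ∣
    delete-shrinks y∈ with x Fin.≟ x
    ... | yes _  = x∈p⇒∣p-x∣<∣p∣ y∈
    ... | no x≢x = ⊥-elim (x≢x refl)

    -- Rows other than `x` keep all their entries, so a set avoiding `x` keeps all its neighbours
    -- and cannot violate Hall's condition.
    delete-violation : ∀ {S} → Hall G → ∣ neighbours (delete G x y) S ∣ < ∣ S ∣ → x ∈ S
    delete-violation {S} hall lt with x ∈? S
    ... | yes x∈S = x∈S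
    ... | no  x∉S = ⊥-elim (<⇒≱ lt (≤-trans (hall S) (p⊆q⇒∣p∣≤∣q∣ λ w∈ →
          let z , z∈S , w∈Gz = ∈-neighbours⁻ {G = G} w∈
          in ∈-neighbours⁺ {G = delete G x y} z∈S (∈-delete⁺ w∈Gz (inj₁ λ { refl → x∉S z∈S })))))

  -- Rado's argument: sets violating Hall's condition after either deletion would, by
  -- submodularity of S ↦ ∣ N(S) ∣, already violate it before.
  Hall-delete : (G : Fin n → Subset m) (x : Fin n) {y₁ y₂ : Fin m} → y₁ ≢ y₂ →
                Hall G → Hall (delete G x y₁) ⊎ Hall (delete G x y₂)
  Hall-delete G x {y₁} {y₂} y₁≢y₂ hall with Hall? (delete G x y₁) | Hall? (delete G x y₂)
  ... | inj₁ ok        | _              = inj₁ ok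
  ... | inj₂ _         | inj₁ ok        = inj₂ ok
  ... | inj₂ (S₁ , lt₁) | inj₂ (S₂ , lt₂) = ⊥-elim (<-irrefl refl contra)
    where
    open ≤-Reasoning
    N₁ = neighbours (delete G x y₁) S₁
    N₂ = neighbours (delete G x y₂) S₂
    x∈S₁ : x ∈ S₁
    x∈S₁ = delete-violation G x y₁ hall lt₁
    x∈S₂ : x ∈ S₂
    x∈S₂ = delete-violation G x y₂ hall lt₂
    -- Both sets contain `x`, and as `y₁ ≢ y₂`, every edge at `x` survives one of the two deletions.
    union : neighbours G (S₁ ∪ S₂) ⊆ N₁ ∪ N₂
    union {w} w∈ with ∈-neighbours⁻ {G = G} w∈
    ... | z , z∈ , w∈Gz with z Fin.≟ x
    union {w} w∈ | z , z∈ , w∈Gz | no z≢x with x∈p∪q⁻ S₁ S₂ z∈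
    ... | inj₁ z∈₁ = x∈p∪q⁺ (inj₁ (∈-neighbours⁺ {G = delete G x y₁} z∈₁ (∈-delete⁺ G x y₁ w∈Gz (inj₁ z≢x))))
    ... | inj₂ z∈₂ = x∈p∪q⁺ (inj₂ (∈-neighbours⁺ {G = delete G x y₂} z∈₂ (∈-delete⁺ G x y₂ w∈Gz (inj₁ z≢x))))
    union {w} w∈ | z , z∈ , w∈Gz | yes refl with w Fin.≟ y₁
    ... | no w≢y₁  = x∈p∪q⁺ (inj₁ (∈-neighbours⁺ {G = delete G x y₁} x∈S₁ (∈-delete⁺ G x y₁ w∈Gz (inj₂ w≢y₁))))
    ... | yes refl = x∈p∪q⁺ (inj₂ (∈-neighbours⁺ {G = delete G x y₂} x∈S₂ (∈-delete⁺ G x y₂ w∈Gz (inj₂ y₁≢y₂))))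
    -- Away from `x` the deletions change nothing, so a common vertex other than `x` puts its
    -- neighbours into both `N₁` and `N₂`.
    inter : neighbours G ((S₁ ∩ S₂) - x) ⊆ N₁ ∩ N₂
    inter w∈ =
      let z , z∈ , w∈Gz = ∈-neighbours⁻ {G = G} w∈
          z≢x : z ≢ x
          z≢x z≡x = x∈p─q⇒x∉q (S₁ ∩ S₂) ⁅ x ⁆ z∈ (subst (_∈ ⁅ x ⁆) (sym z≡x) (x∈⁅x⁆ x))
          z∈₁ , z∈₂ = x∈p∩q⁻ S₁ S₂ (p─q⊆p (S₁ ∩ S₂) ⁅ x ⁆ z∈)
      in x∈p∩q⁺ ( ∈-neighbours⁺ {G = delete G x y₁} z∈₁ (∈-delete⁺ G x y₁ w∈Gz (inj₁ z≢x))
                , ∈-neighbours⁺ {G = delete G x y₂} z∈₂ (∈-delete⁺ G x y₂ w∈Gz (inj₁ z≢x)))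
    -- Removing `x` from the intersection costs one, whereas the two strict violations gain two.
    contra : ∣ S₁ ∣ + ∣ S₂ ∣ < ∣ S₁ ∣ + ∣ S₂ ∣
    contra = begin-strict
      ∣ S₁ ∣ + ∣ S₂ ∣                                ≡⟨ ∣p∪q∣+∣p∩q∣≡∣p∣+∣q∣ S₁ S₂ ⟨
      ∣ S₁ ∪ S₂ ∣ + ∣ S₁ ∩ S₂ ∣                      ≤⟨ +-monoʳ-≤ ∣ S₁ ∪ S₂ ∣ (∣p∣≤1+∣p-x∣ (S₁ ∩ S₂) x) ⟩
      ∣ S₁ ∪ S₂ ∣ + suc ∣ (S₁ ∩ S₂) - x ∣            ≤⟨ +-mono-≤ (≤-trans (hall (S₁ ∪ S₂)) (p⊆q⇒∣p∣≤∣q∣ union))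
                                                          (s≤s (≤-trans (hall ((S₁ ∩ S₂) - x)) (p⊆q⇒∣p∣≤∣q∣ inter))) ⟩
      ∣ N₁ ∪ N₂ ∣ + suc ∣ N₁ ∩ N₂ ∣                  ≡⟨ +-suc _ _ ⟩
      suc (∣ N₁ ∪ N₂ ∣ + ∣ N₁ ∩ N₂ ∣)                ≡⟨ cong suc (∣p∪q∣+∣p∩q∣≡∣p∣+∣q∣ N₁ N₂) ⟩
      suc ∣ N₁ ∣ + ∣ N₂ ∣                            <⟨ +-mono-≤-< lt₁ lt₂ ⟩
      ∣ S₁ ∣ + ∣ S₂ ∣                                ∎

  AtMostOne : Subset m → Set
  AtMostOne p = ∀ {y₁ y₂} → y₁ ∈ p → y₂ ∈ p → y₁ ≡ y₂

  AtMostOne? : (p : Subset m) → AtMostOne p ⊎ ∃₂ λ y₁ y₂ → y₁ ∈ p × y₂ ∈ p × y₁ ≢ y₂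
  AtMostOne? p with Fin.any? (λ y₁ → Fin.any? λ y₂ → (y₁ ∈? p) ×-dec (y₂ ∈? p) ×-dec ¬? (y₁ Fin.≟ y₂))
  ... | yes two = inj₂ two
  ... | no ¬two = inj₁ λ {y₁} {y₂} y₁∈ y₂∈ → case-≟ y₁ y₂ y₁∈ y₂∈
    where
    case-≟ : ∀ y₁ y₂ → y₁ ∈ p → y₂ ∈ p → y₁ ≡ y₂
    case-≟ y₁ y₂ y₁∈ y₂∈ with y₁ Fin.≟ y₂
    ... | yes eq = eq
    ... | no  ne = ⊥-elim (¬two (y₁ , y₂ , y₁∈ , y₂∈ , ne))

  Refinement : (Fin n → Subset m) → (Fin n → Set) → Set
  Refinement {n} {m} G Q = Σ (Fin n → Subset m) λ G′ → (∀ z → G′ z ⊆ G z) × Hall G′ × ∀ z → Q z → AtMostOne (G′ z)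

  -- As long as row `x` has two entries, `Hall-delete` allows one of them to go. Each deletion
  -- shrinks that row, so `fuel` above its size suffices.
  refine-row : (fuel : ℕ) (G : Fin n → Subset m) (x : Fin n) → ∣ G x ∣ < fuel →
               Hall G → Refinement G (_≡ x)
  refine-row (suc fuel) G x lt hall with AtMostOne? (G x)
  ... | inj₁ one = G , (λ _ → id) , hall , λ { _ refl → one }
  ... | inj₂ (y₁ , y₂ , y₁∈ , y₂∈ , y₁≢y₂) with Hall-delete G x y₁≢y₂ hall
  ...   | inj₁ hall₁ =
          let G′ , sub , hall′ , one = refine-row fuel (delete G x y₁) x
                (≤-trans (delete-shrinks G x y₁ y₁∈) (s≤s⁻¹ lt)) hall₁
          in G′ , (λ z → delete⊆ G x y₁ z ∘ sub z) , hall′ , one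
  ...   | inj₂ hall₂ =
          let G′ , sub , hall′ , one = refine-row fuel (delete G x y₂) x
                (≤-trans (delete-shrinks G x y₂ y₂∈) (s≤s⁻¹ lt)) hall₂
          in G′ , (λ z → delete⊆ G x y₂ z ∘ sub z) , hall′ , one

  refine-rows : (G : Fin n → Subset m) (xs : List (Fin n)) → Hall G → Refinement G (_∈ˡ xs)
  refine-rows G []       hall = G , (λ _ → id) , hall , λ _ ()
  refine-rows G (x ∷ xs) hall =
    let G₁ , sub₁ , hall₁ , one₁ = refine-row (suc ∣ G x ∣) G x ≤-refl hall
        G₂ , sub₂ , hall₂ , one₂ = refine-rows G₁ xs hall₁
    in G₂ , (λ z → sub₁ z ∘ sub₂ z) , hall₂ ,
       -- Later reductions only shrink rows, so row `x` keeps at most one entry.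
       λ { z (here refl) y₁∈ y₂∈ → one₁ x refl (sub₂ z y₁∈) (sub₂ z y₂∈)
         ; z (there z∈)          → one₂ z z∈ }

  -- After `refine-rows` each row offers at most one choice. Hall's condition for singletons makes
  -- the choice exist, and for pairs it makes the choices distinct.
  hall : (G : Fin n → Subset m) → Hall G → ∃ λ f → Injective _≡_ _≡_ f × ∀ x → f x ∈ G x
  hall {n} {m} G hallG = f , inj , λ x → sub x (f∈ x)
    where
    refinement : Refinement G (_∈ˡ allFin n)
    refinement = refine-rows G (allFin n) hallG
    G′ = proj₁ refinement
    sub = proj₁ (proj₂ refinement)
    hall′ = proj₁ (proj₂ (proj₂ refinement))
    one : ∀ x → AtMostOne (G′ x)
    one x = proj₂ (proj₂ (proj₂ refinement)) x (∈-allFin x)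

    choose : ∀ x → ∃ λ y → y ∈ G′ x
    choose x with nonempty? (neighbours G′ ⁅ x ⁆)
    ... | no  empty = ⊥-elim (<-irrefl refl (begin-strict
            0                            <⟨ ≤-reflexive (sym (∣⁅x⁆∣≡1 x)) ⟩
            ∣ ⁅ x ⁆ ∣                    ≤⟨ hall′ ⁅ x ⁆ ⟩
            ∣ neighbours G′ ⁅ x ⁆ ∣      ≡⟨ cong ∣_∣ (Empty-unique empty) ⟩
            ∣ ∅ {m} ∣                    ≡⟨ ∣⊥∣≡0 m ⟩
            0                            ∎))
      where open ≤-Reasoning
    ... | yes (y , y∈) =
          let z , z∈ , y∈Gz = ∈-neighbours⁻ {G = G′} y∈
          in y , subst (λ z → y ∈ G′ z) (x∈⁅y⁆⇒x≡y x z∈) y∈Gz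

    f = proj₁ ∘ choose
    f∈ = proj₂ ∘ choose

    inj : Injective _≡_ _≡_ f
    inj {x} {x′} fx≡fx′ with x Fin.≟ x′
    ... | yes eq = eq
    ... | no  ne = ⊥-elim (<-irrefl refl (begin-strict
          1                              ≡⟨ ∣⁅x⁆∣≡1 x ⟨
          ∣ ⁅ x ⁆ ∣                      ≤⟨ p⊆q⇒∣p∣≤∣q∣ x∈pair-x′ ⟩
          ∣ pair - x′ ∣                  <⟨ x∈p⇒∣p-x∣<∣p∣ {p = pair} (x∈p∪q⁺ (inj₂ (x∈⁅x⁆ x′))) ⟩
          ∣ pair ∣                       ≤⟨ hall′ pair ⟩
          ∣ neighbours G′ pair ∣         ≤⟨ p⊆q⇒∣p∣≤∣q∣ images ⟩
          ∣ ⁅ f x ⁆ ∣                    ≡⟨ ∣⁅x⁆∣≡1 (f x) ⟩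
          1                              ∎))
      where
      open ≤-Reasoning
      pair = ⁅ x ⁆ ∪ ⁅ x′ ⁆
      x∈pair-x′ : ⁅ x ⁆ ⊆ pair - x′
      x∈pair-x′ z∈ with refl ← x∈⁅y⁆⇒x≡y x z∈ = x∈p∧x≢y⇒x∈p-y (x∈p∪q⁺ (inj₁ (x∈⁅x⁆ x))) ne
      images : neighbours G′ pair ⊆ ⁅ f x ⁆
      images w∈ with ∈-neighbours⁻ {G = G′} w∈
      ... | z , z∈ , w∈Gz with x∈p∪q⁻ ⁅ x ⁆ ⁅ x′ ⁆ z∈
      ...   | inj₁ z∈₁ rewrite x∈⁅y⁆⇒x≡y x z∈₁ =
              subst (_∈ ⁅ f x ⁆) (one x (f∈ x) w∈Gz) (x∈⁅x⁆ (f x))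
      ...   | inj₂ z∈₂ rewrite x∈⁅y⁆⇒x≡y x′ z∈₂ =
              subst (_∈ ⁅ f x ⁆) (trans fx≡fx′ (one x′ (f∈ x′) w∈Gz)) (x∈⁅x⁆ (f x))

  -- Pigeonhole: if `y` were missed, punching it out of the codomain would inject a set into one
  -- with one element fewer.
  injective⇒inverse : {f : Fin n → Fin n} → Injective _≡_ _≡_ f →
                      ∃ λ g → (∀ x → f (g x) ≡ x) × (∀ x → g (f x) ≡ x)
  injective⇒inverse {n} {f} inj = g , fg , λ x → inj (fg (f x))
    where
    hit : ∀ {n} {f : Fin n → Fin n} → Injective _≡_ _≡_ f → ∀ y → ∃ λ x → f x ≡ y
    hit {suc n} {f} inj y with Fin.any? (λ x → f x Fin.≟ y)
    ... | yes found = found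
    ... | no ¬found = ⊥-elim (1+n≰n (Fin.injective⇒≤ {f = λ x → punchOut {i = y} {f x} (λ y≡fx → ¬found (x , sym y≡fx))}
                        λ {a} {b} eq → inj (Fin.punchOut-injective {i = y} {f a} {f b} _ _ eq)))
    g = proj₁ ∘ hit inj
    fg = proj₂ ∘ hit inj

  -- Matrices with constant line sums

  𝟙 : ∀ {p} {P : Set p} → Dec P → ℕ
  𝟙 P? = if does P? then 1 else 0

  𝟙-true : ∀ {p} {P : Set p} (P? : Dec P) → P → 𝟙 P? ≡ 1
  𝟙-true P? p rewrite dec-true P? p = refl

  𝟙-false : ∀ {p} {P : Set p} (P? : Dec P) → ¬ P → 𝟙 P? ≡ 0
  𝟙-false P? ¬p rewrite dec-false P? ¬p = refl

  𝟙-mono : ∀ {p q} {P : Set p} {Q : Set q} (P? : Dec P) (Q? : Dec Q) → (P → Q) → 𝟙 P? ≤ 𝟙 Q?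
  𝟙-mono (yes p) Q? P⇒Q rewrite dec-true Q? (P⇒Q p) = ≤-refl
  𝟙-mono (no _)  Q? P⇒Q = z≤n

  𝟙-cong : ∀ {p q} {P : Set p} {Q : Set q} (P? : Dec P) (Q? : Dec Q) → (P → Q) → (Q → P) → 𝟙 P? ≡ 𝟙 Q?
  𝟙-cong P? Q? P⇒Q Q⇒P = ≤-antisym (𝟙-mono P? Q? P⇒Q) (𝟙-mono Q? P? Q⇒P)

  sum-mono : {f g : Fin n → ℕ} → (∀ i → f i ≤ g i) → sum f ≤ sum g
  sum-mono {zero}  f≤g = z≤n
  sum-mono {suc n} f≤g = +-mono-≤ (f≤g zero) (sum-mono (f≤g ∘ suc))

  sum-zero : {f : Fin n → ℕ} → (∀ i → f i ≡ 0) → sum f ≡ 0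
  sum-zero {n} f≡0 = trans (Sum.sum-cong-≋ f≡0) (Sum.sum-replicate-zero n)

  sum-point : (x : Fin n) → sum (λ y → 𝟙 (x Fin.≟ y)) ≡ 1
  sum-point {suc n} zero    = cong suc (sum-zero {n} λ _ → refl)
  sum-point {suc n} (suc x) = sum-point x

  ∣p∣≡sum : (p : Subset n) → ∣ p ∣ ≡ sum λ x → 𝟙 (x ∈? p)
  ∣p∣≡sum Vec.[]              = refl
  ∣p∣≡sum (inside  Vec.∷ p) = cong suc (∣p∣≡sum p)
  ∣p∣≡sum (outside Vec.∷ p) = ∣p∣≡sum p

  Regular : ℕ → (Fin n → Fin n → ℕ) → Set
  Regular k M = (∀ x → sum (M x) ≡ k) × (∀ y → sum (λ x → M x y) ≡ k)

  support : (Fin n → Fin n → ℕ) → Fin n → Subset n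
  support M x = select (λ y → 1 ≤? M x y)

  -- Double counting of mass: the rows in `S` carry `∣ S ∣ * suc k`, all of it in the columns of
  -- `N`, and these carry `∣ N ∣ * suc k` in total.
  Regular⇒Hall : (M : Fin n → Fin n → ℕ) → Regular (suc k) M → Hall (support M)
  Regular⇒Hall {k = k} M (rows , cols) S = *-cancelʳ-≤ ∣ S ∣ ∣ N ∣ (suc k) (begin
    ∣ S ∣ * suc k                                      ≡⟨ cong (_* suc k) (∣p∣≡sum S) ⟩
    sum (λ x → 𝟙 (x ∈? S)) * suc k                     ≡⟨ Sum.*-distribʳ-sum (suc k) (λ x → 𝟙 (x ∈? S)) ⟩
    sum (λ x → 𝟙 (x ∈? S) * suc k)                     ≡⟨ Sum.sum-cong-≋ (λ x → cong (𝟙 (x ∈? S) *_) (sym (rows x))) ⟩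
    sum (λ x → 𝟙 (x ∈? S) * sum (M x))                 ≡⟨ Sum.sum-cong-≋ (λ x → Sum.*-distribˡ-sum (𝟙 (x ∈? S)) (M x)) ⟩
    sum (λ x → sum (λ y → 𝟙 (x ∈? S) * M x y))         ≤⟨ sum-mono (λ x → sum-mono (entry x)) ⟩
    sum (λ x → sum (λ y → M x y * 𝟙 (y ∈? N)))         ≡⟨ Sum.∑-comm (λ x y → M x y * 𝟙 (y ∈? N)) ⟩
    sum (λ y → sum (λ x → M x y * 𝟙 (y ∈? N)))         ≡⟨ Sum.sum-cong-≋ (λ y → sym (Sum.*-distribʳ-sum (𝟙 (y ∈? N)) (λ x → M x y))) ⟩
    sum (λ y → sum (λ x → M x y) * 𝟙 (y ∈? N))         ≡⟨ Sum.sum-cong-≋ (λ y → trans (cong (_* 𝟙 (y ∈? N)) (cols y)) (*-comm (suc k) _)) ⟩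
    sum (λ y → 𝟙 (y ∈? N) * suc k)                     ≡⟨ Sum.*-distribʳ-sum (suc k) (λ y → 𝟙 (y ∈? N)) ⟨
    sum (λ y → 𝟙 (y ∈? N)) * suc k                     ≡⟨ cong (_* suc k) (∣p∣≡sum N) ⟨
    ∣ N ∣ * suc k                                      ∎)
    where
    open ≤-Reasoning
    N = neighbours (support M) S
    entry : ∀ x y → 𝟙 (x ∈? S) * M x y ≤ M x y * 𝟙 (y ∈? N)
    entry x y with x ∈? S | M x y in eq
    ... | no _    | _     = z≤n
    ... | yes _   | zero  = z≤n
    ... | yes x∈S | suc j = ≤-reflexive (trans (*-identityˡ (suc j)) (trans (sym (*-identityʳ (suc j)))
            (cong (suc j *_) (sym (𝟙-true (y ∈? N) (∈-neighbours⁺ {G = support M} x∈S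
              (∈-select⁺ (λ y → 1 ≤? M x y) (subst (1 ≤_) (sym eq) (s≤s z≤n)))))))))

  abstract
    Regular⇒transversal : (M : Fin n → Fin n → ℕ) → Regular (suc k) M →
                          ∃ λ f → Injective _≡_ _≡_ f × ∀ x → 1 ≤ M x (f x)
    Regular⇒transversal M reg =
      let f , inj , f∈ = hall (support M) (Regular⇒Hall M reg)
      in f , inj , λ x → ∈-select⁻ (λ y → 1 ≤? M x y) (f∈ x)

  _⊝_ : (Fin n → Fin n → ℕ) → (Fin n → Fin n) → Fin n → Fin n → ℕ
  (M ⊝ f) x y = M x y ∸ 𝟙 (f x Fin.≟ y)

  -- An injective `f` on a finite set is a bijection, so subtracting its permutation matrix lowers
  -- each row sum and each column sum by exactly one.
  Regular-⊝ : (M : Fin n → Fin n → ℕ) {f : Fin n → Fin n} → Injective _≡_ _≡_ f →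
              (∀ x → 1 ≤ M x (f x)) → Regular (suc k) M → Regular k (M ⊝ f)
  Regular-⊝ {n} {k} M {f} inj pos (rows , cols) = rows′ , cols′
    where
    open ≡-Reasoning
    -- `pos` is what makes the truncated subtraction exact.
    restore : ∀ x y → (M ⊝ f) x y + 𝟙 (f x Fin.≟ y) ≡ M x y
    restore x y with f x Fin.≟ y
    ... | yes refl = m∸n+n≡m (pos x)
    ... | no _     = +-identityʳ _
    line : (u v w : Fin n → ℕ) → (∀ i → u i + v i ≡ w i) → sum v ≡ 1 → sum w ≡ suc k → sum u ≡ k
    line u v w uv v≡1 w≡ = +-cancelʳ-≡ 1 (sum u) k (begin
      sum u + 1               ≡⟨ cong (sum u +_) v≡1 ⟨
      sum u + sum v           ≡⟨ Sum.∑-distrib-+ u v ⟨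
      sum (λ i → u i + v i)   ≡⟨ Sum.sum-cong-≋ uv ⟩
      sum w                   ≡⟨ w≡ ⟩
      suc k                   ≡⟨ +-comm 1 k ⟩
      k + 1                   ∎)
    g = proj₁ (injective⇒inverse inj)
    fg = proj₁ (proj₂ (injective⇒inverse inj))
    gf = proj₂ (proj₂ (injective⇒inverse inj))
    rows′ : ∀ x → sum ((M ⊝ f) x) ≡ k
    rows′ x = line _ _ _ (restore x) (sum-point (f x)) (rows x)
    cols′ : ∀ y → sum (λ x → (M ⊝ f) x y) ≡ k
    cols′ y = line _ _ _ (λ x → restore x y)
      (trans (Sum.sum-cong-≋ λ x → 𝟙-cong (f x Fin.≟ y) (g y Fin.≟ x)
               (λ { refl → gf x }) (λ { refl → fg y })) (sum-point (g y)))
      (cols y)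

  -- The transversals are disjoint with multiplicity: `f₁ x ≡ f₂ x` is possible only where the entry
  -- of `M` is at least 2. The bound `2 ≤ k` keeps the line sums positive after the first removal.
  Regular⇒transversals : (M : Fin n → Fin n → ℕ) → 2 ≤ k → Regular k M →
    ∃₂ λ f₁ f₂ → Injective _≡_ _≡_ f₁ × Injective _≡_ _≡_ f₂ ×
      (∀ x → 1 ≤ M x (f₁ x)) × (∀ x → 1 ≤ (M ⊝ f₁) x (f₂ x))
  Regular⇒transversals M (s≤s (s≤s z≤n)) reg =
    let f₁ , f₁-inj , pos₁ = Regular⇒transversal M reg
        f₂ , f₂-inj , pos₂ = Regular⇒transversal (M ⊝ f₁) (Regular-⊝ M f₁-inj pos₁ reg)
    in f₁ , f₂ , f₁-inj , f₂-inj , pos₁ , pos₂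

  -- The linking permutation of a bipartite graph.

  length-filter-filter : ∀ {a p q} {A : Set a} {P : Pred A p} {Q : Pred A q}
    (P? : Decidable P) (Q? : Decidable Q) (g : Fin n → A) →
    length (filter P? (filter Q? (List.tabulate g))) ≡ sum λ i → 𝟙 (Q? (g i) ×-dec P? (g i))
  length-filter-filter {n = zero}  P? Q? g = refl
  length-filter-filter {n = suc n} P? Q? g with Q? (g zero)
  ... | no _ = length-filter-filter P? Q? (g ∘ suc)
  ... | yes _ with P? (g zero)
  ...   | yes _ = cong suc (length-filter-filter P? Q? (g ∘ suc))
  ...   | no _  = length-filter-filter P? Q? (g ∘ suc)

  module Linking {n k : ℕ} (A B : Subset n) (T : Fin n → Subset n)
    (disjoint : ∀ {v} → v ∈ A → v ∉ B) (T⊆B : ∀ {y} → y ∈ A → T y ⊆ B)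
    (size≤k : ∀ {y} → y ∈ A → ∣ T y ∣ ≤ k)
    (occurrence≤k : ∀ {x} → x ∈ B → length (filter (λ y → x ∈? T y) (elements A)) ≤ k)
    where

    edge? : ∀ x y → Dec (y ∈ A × x ∈ T y)
    edge? x y = (y ∈? A) ×-dec (x ∈? T y)

    -- The symmetrised adjacency matrix, with both sides of the graph inside one vertex set, so that
    -- a transversal is a permutation of `Fin n`. As `A` and `B` are disjoint, at most one summand
    -- is nonzero.
    incidence : Fin n → Fin n → ℕ
    incidence u v = 𝟙 (edge? u v) + 𝟙 (edge? v u)

    degree : Fin n → ℕ
    degree u = sum (incidence u)

    edge⇒∈B : ∀ {x y} → y ∈ A × x ∈ T y → x ∈ B
    edge⇒∈B (y∈A , x∈Ty) = T⊆B y∈A x∈Ty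

    incidence-A : ∀ {u} → u ∈ A → ∀ v → incidence u v ≡ 𝟙 (edge? v u)
    incidence-A {u} u∈A v = cong (_+ 𝟙 (edge? v u)) (𝟙-false (edge? u v) (disjoint u∈A ∘ edge⇒∈B))

    incidence-∉A : ∀ {u} → u ∉ A → ∀ v → incidence u v ≡ 𝟙 (edge? u v)
    incidence-∉A {u} u∉A v =
      trans (cong (𝟙 (edge? u v) +_) (𝟙-false (edge? v u) (u∉A ∘ proj₁))) (+-identityʳ _)

    degree-∉A : ∀ {x} → x ∉ A → degree x ≡ length (filter (λ y → x ∈? T y) (elements A))
    degree-∉A {x} x∉A = trans (Sum.sum-cong-≋ (incidence-∉A x∉A))
      (sym (length-filter-filter (λ y → x ∈? T y) (_∈? A) id))

    degree≤k : ∀ u → degree u ≤ k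
    degree≤k u = cases (u ∈? A) (u ∈? B)
      where
      open ≤-Reasoning
      cases : Dec (u ∈ A) → Dec (u ∈ B) → degree u ≤ k
      cases (yes u∈A) _ = begin
        degree u                        ≡⟨ Sum.sum-cong-≋ (incidence-A u∈A) ⟩
        sum (λ v → 𝟙 (edge? v u))       ≤⟨ sum-mono (λ v → 𝟙-mono (edge? v u) (v ∈? T u) proj₂) ⟩
        sum (λ v → 𝟙 (v ∈? T u))        ≡⟨ ∣p∣≡sum (T u) ⟨
        ∣ T u ∣                         ≤⟨ size≤k u∈A ⟩
        k                               ∎
      cases (no u∉A) (yes u∈B) = subst (_≤ k) (sym (degree-∉A u∉A)) (occurrence≤k u∈B)
      cases (no u∉A) (no u∉B)  = subst (_≤ k) (sym (sum-zero λ v →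
        trans (incidence-∉A u∉A v) (𝟙-false (edge? u v) (u∉B ∘ edge⇒∈B)))) z≤n

    -- The diagonal entries make all line sums equal to k.
    padded : Fin n → Fin n → ℕ
    padded u v = incidence u v + 𝟙 (u Fin.≟ v) * (k ∸ degree u)

    padded-sym : ∀ u v → padded u v ≡ padded v u
    padded-sym u v = cong₂ _+_ (+-comm (𝟙 (edge? u v)) (𝟙 (edge? v u))) diagonal
      where
      diagonal : 𝟙 (u Fin.≟ v) * (k ∸ degree u) ≡ 𝟙 (v Fin.≟ u) * (k ∸ degree v)
      diagonal with u Fin.≟ v
      ... | yes refl = cong (_* (k ∸ degree u)) (sym (𝟙-true (u Fin.≟ u) refl))
      ... | no u≢v   = cong (_* (k ∸ degree v)) (sym (𝟙-false (v Fin.≟ u) (u≢v ∘ sym)))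

    padded-regular : Regular k padded
    padded-regular = rows , λ v → trans (Sum.sum-cong-≋ λ u → padded-sym u v) (rows v)
      where
      open ≡-Reasoning
      rows : ∀ u → sum (padded u) ≡ k
      rows u = begin
        sum (padded u)                                              ≡⟨ Sum.∑-distrib-+ (incidence u) _ ⟩
        degree u + sum (λ v → 𝟙 (u Fin.≟ v) * (k ∸ degree u))       ≡⟨ cong (degree u +_) (Sum.*-distribʳ-sum (k ∸ degree u) (λ v → 𝟙 (u Fin.≟ v))) ⟨
        degree u + sum (λ v → 𝟙 (u Fin.≟ v)) * (k ∸ degree u)       ≡⟨ cong (λ s → degree u + s * (k ∸ degree u)) (sum-point u) ⟩
        degree u + (k ∸ degree u + 0)                               ≡⟨ cong (degree u +_) (+-identityʳ _) ⟩
        degree u + (k ∸ degree u)                                   ≡⟨ m+[n∸m]≡n (degree≤k u) ⟩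
        k                                                           ∎

    -- A vertex of full degree gets a loop of weight 0, so in its row a transversal can only use
    -- genuine edges.
    padded-full : ∀ {x} → x ∉ A → degree x ≡ k → ∀ y → padded x y ≡ 𝟙 (edge? x y)
    padded-full {x} x∉A full y = begin
      incidence x y + 𝟙 (x Fin.≟ y) * (k ∸ degree x)   ≡⟨ cong (λ d → incidence x y + 𝟙 (x Fin.≟ y) * (k ∸ d)) full ⟩
      incidence x y + 𝟙 (x Fin.≟ y) * (k ∸ k)          ≡⟨ cong (λ d → incidence x y + 𝟙 (x Fin.≟ y) * d) (n∸n≡0 k) ⟩
      incidence x y + 𝟙 (x Fin.≟ y) * 0                ≡⟨ cong (incidence x y +_) (*-zeroʳ (𝟙 (x Fin.≟ y))) ⟩
      incidence x y + 0                                ≡⟨ +-identityʳ _ ⟩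
      incidence x y                                    ≡⟨ incidence-∉A x∉A y ⟩
      𝟙 (edge? x y)                                    ∎
      where open ≡-Reasoning

    Linked : Permutation′ n → Set
    Linked σ = ∀ {x} → x ∈ B → length (filter (λ y → x ∈? T y) (elements A)) ≡ k →
      ∃ λ y → (y ∈ A × x ∈ T y) × (σ ⟨$⟩ʳ y ∈ A × x ∈ T (σ ⟨$⟩ʳ y)) × y ≢ σ ⟨$⟩ʳ y

    -- With `σ` the composite of `f₂` with the inverse of `f₁`, the image of `f₁ x` is `f₂ x` for
    -- all `x` at once, so one permutation serves every element of full degree, with witness `f₁ x`.
    linking-by : ∀ f₁ f₂ →
      (∀ x → 1 ≤ padded x (f₁ x)) → (∀ x → 1 ≤ (padded ⊝ f₁) x (f₂ x)) →
      (∃ λ g → (∀ x → f₁ (g x) ≡ x) × (∀ x → g (f₁ x) ≡ x)) →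
      (∃ λ g → (∀ x → f₂ (g x) ≡ x) × (∀ x → g (f₂ x) ≡ x)) → ∃ Linked
    linking-by f₁ f₂ pos₁ pos₂ inv₁ inv₂ = σ , linked
      where
      g₁ = proj₁ inv₁
      g₂ = proj₁ inv₂
      σ : Permutation′ n
      σ = permutation (f₂ ∘ g₁) (f₁ ∘ g₂)
        (λ x → trans (cong f₂ (proj₂ (proj₂ inv₁) (g₂ x))) (proj₁ (proj₂ inv₂) x))
        (λ x → trans (cong f₁ (proj₂ (proj₂ inv₂) (g₁ x))) (proj₁ (proj₂ inv₁) x))
      𝟙-pos : ∀ {p} {P : Set p} (P? : Dec P) → 1 ≤ 𝟙 P? → P
      𝟙-pos (yes p) _ = p
      linked : Linked σ
      linked {x} x∈B len = f₁ x , e₁ , subst (λ z → z ∈ A × x ∈ T z) (sym σf₁) e₂ ,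
                           λ eq → apart (trans eq σf₁)
        where
        x∉A : x ∉ A
        x∉A x∈A = disjoint x∈A x∈B
        entry = padded-full x∉A (trans (degree-∉A x∉A) len)
        σf₁ : f₂ (g₁ (f₁ x)) ≡ f₂ x
        σf₁ = cong f₂ (proj₂ (proj₂ inv₁) x)
        e₁ : f₁ x ∈ A × x ∈ T (f₁ x)
        e₁ = 𝟙-pos (edge? x (f₁ x)) (subst (1 ≤_) (entry (f₁ x)) (pos₁ x))
        e₂ : f₂ x ∈ A × x ∈ T (f₂ x)
        e₂ = 𝟙-pos (edge? x (f₂ x)) (subst (1 ≤_) (entry (f₂ x)) (≤-trans (pos₂ x) (m∸n≤m (padded x (f₂ x)) (𝟙 (f₁ x Fin.≟ f₂ x)))))
        -- Entries in the row of `x` are at most 1, so the first transversal leaves nothing at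
        -- column `f₁ x`.
        apart : f₁ x ≢ f₂ x
        apart eq = 1+n≰n (begin
          1                                                       ≤⟨ pos₂ x ⟩
          padded x (f₂ x) ∸ 𝟙 (f₁ x Fin.≟ f₂ x)                   ≡⟨ cong₂ _∸_ (entry (f₂ x)) (𝟙-true (f₁ x Fin.≟ f₂ x) eq) ⟩
          𝟙 (edge? x (f₂ x)) ∸ 1                                  ≡⟨ cong (_∸ 1) (𝟙-true (edge? x (f₂ x)) e₂) ⟩
          0                                                       ∎)
          where open ≤-Reasoning

    linking : 2 ≤ k → ∃ Linked
    linking 2≤k with Regular⇒transversals padded 2≤k padded-regular
    ... | f₁ , f₂ , f₁-inj , f₂-inj , pos₁ , pos₂ =
      linking-by f₁ f₂ pos₁ pos₂ (injective⇒inverse f₁-inj) (injective⇒inverse f₂-inj)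

  -- Greedy colouring

  -- If every colour occurred in `cs`, sending a colour to its position would inject `Fin m` into
  -- fewer than `m` positions.
  fresh : (cs : List (Fin m)) → length cs < m → ∃ λ c → c ∉ˡ cs
  fresh {m} cs lt with Fin.any? (λ c → ¬? (c ∈ˡ? cs))
    where open DecMembership (Fin._≟_ {m}) renaming (_∈?_ to _∈ˡ?_)
  ... | yes found = found
  ... | no ¬found = ⊥-elim (<⇒≱ lt (Fin.injective⇒≤ {f = position} position-injective))
    where
    open DecMembership (Fin._≟_ {m}) renaming (_∈?_ to _∈ˡ?_)
    all∈ : ∀ c → c ∈ˡ cs
    all∈ c = decidable-stable (c ∈ˡ? cs) λ c∉ → ¬found (c , c∉)
    position : Fin m → Fin (length cs)
    position c = index (all∈ c)
    position-injective : ∀ {c d} → position c ≡ position d → c ≡ d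
    position-injective {c} {d} eq = trans (lookup-index (all∈ c))
      (trans (cong (List.lookup cs) eq) (sym (lookup-index (all∈ d))))

  greedy-colouring : (nb : Fin n → List (Fin n)) → (∀ {u v} → u ∈ˡ nb v → v ∈ˡ nb u) →
    (∀ v → length (nb v) < m) →
    ∃ λ (col : Fin n → Fin m) → ∀ {u v} → u ∈ˡ nb v → u ≢ v → col u ≢ col v
  greedy-colouring {n} {m} nb nb-sym few =
    let col , proper = colour (allFin n) in col , proper (∈-allFin _) (∈-allFin _)
    where
    Proper : List (Fin n) → (Fin n → Fin m) → Set
    Proper vs col = ∀ {u v} → u ∈ˡ vs → v ∈ˡ vs → u ∈ˡ nb v → u ≢ v → col u ≢ col v

    colour : ∀ vs → ∃ (Proper vs)
    -- No constraint applies yet; `few v` merely supplies an element of `Fin m`.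
    colour []       = (λ v → fromℕ< (few v)) , λ ()
    colour (w ∷ vs) = recolour , λ u∈ v∈ → proper′ (tail∈ u∈) (tail∈ v∈)
      where
      col = proj₁ (colour vs)
      proper = proj₂ (colour vs)
      -- The new colour avoids the current colours of all neighbours of `w`, in particular of those
      -- in `vs`.
      new = fresh (List.map col (nb w)) (subst (_< m) (sym (length-map col (nb w))) (few w))

      recolour : Fin n → Fin m
      recolour v with v Fin.≟ w
      ... | yes _ = proj₁ new
      ... | no  _ = col v

      tail∈ : ∀ {v} → v ∈ˡ w ∷ vs → v ≢ w → v ∈ˡ vs
      tail∈ (here eq)  v≢w = ⊥-elim (v≢w eq)
      tail∈ (there v∈) v≢w = v∈

      proper′ : ∀ {u v} → (u ≢ w → u ∈ˡ vs) → (v ≢ w → v ∈ˡ vs) → u ∈ˡ nb v → u ≢ v → recolour u ≢ recolour v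
      proper′ {u} {v} u∈ v∈ u∈nb u≢v eq with u Fin.≟ w | v Fin.≟ w
      ... | yes refl | yes refl = u≢v refl
      ... | yes refl | no v≢w   = proj₂ new (subst (_∈ˡ _) (sym eq) (∈-map⁺ col (nb-sym u∈nb)))
      ... | no u≢w   | yes refl = proj₂ new (subst (_∈ˡ _) eq (∈-map⁺ col u∈nb))
      ... | no u≢w   | no v≢w   = proper (u∈ u≢w) (v∈ v≢w) u∈nb u≢v eq

  -- Orbits of a permutation

  fold-shift : ∀ {a} {A : Set a} (f : A → A) z i → fold (f z) f i ≡ f (fold z f i)
  fold-shift f z zero    = refl
  fold-shift f z (suc i) = cong f (fold-shift f z i)

  fold-inverse : ∀ {a} {A : Set a} {f g : A → A} → (∀ z → f (g z) ≡ z) → ∀ i z → fold (fold z g i) f i ≡ z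
  fold-inverse fg zero    z = refl
  fold-inverse {f = f} {g} fg (suc i) z =
    trans (sym (fold-shift f (g (fold z g i)) i))
          (trans (cong (λ w → fold w f i) (fg (fold z g i))) (fold-inverse fg i z))

  sum-ones : ∀ n → sum {n} (λ _ → 1) ≡ n
  sum-ones zero    = refl
  sum-ones (suc n) = cong suc (sum-ones n)

  term≤sum : (f : Fin n → ℕ) (i : Fin n) → f i ≤ sum f
  term≤sum f zero    = m≤m+n _ _
  term≤sum f (suc i) = ≤-trans (term≤sum (f ∘ suc) i) (m≤n+m _ _)

  image? : (F : Fin m → Fin n) → Decidable λ y → ∃ λ i → F i ≡ y
  image? F y = Fin.any? λ i → F i Fin.≟ y

  -- Every image point has a nonempty fibre, and the fibres together count each of the `m` indices
  -- once.
  image-size : (F : Fin m → Fin n) → ∣ select (image? F) ∣ ≤ m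
  image-size {m} F = begin
    ∣ select (image? F) ∣                          ≡⟨ ∣p∣≡sum (select (image? F)) ⟩
    sum (λ y → 𝟙 (y ∈? select (image? F)))         ≤⟨ sum-mono fibre ⟩
    sum (λ y → sum (λ i → 𝟙 (F i Fin.≟ y)))        ≡⟨ Sum.∑-comm (λ y i → 𝟙 (F i Fin.≟ y)) ⟩
    sum (λ i → sum (λ y → 𝟙 (F i Fin.≟ y)))        ≡⟨ Sum.sum-cong-≋ (λ i → sum-point (F i)) ⟩
    sum {m} (λ _ → 1)                              ≡⟨ sum-ones m ⟩
    m                                              ∎
    where
    open ≤-Reasoning
    fibre : ∀ y → 𝟙 (y ∈? select (image? F)) ≤ sum (λ i → 𝟙 (F i Fin.≟ y))
    fibre y with y ∈? select (image? F)
    ... | no _   = z≤n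
    ... | yes y∈ = let i , Fi≡y = ∈-select⁻ (image? F) y∈ in
          subst (_≤ _) (𝟙-true (F i Fin.≟ y) Fi≡y) (term≤sum (λ i → 𝟙 (F i Fin.≟ y)) i)

  -- In slot (c , C) of y, the element y is selected when the random colour is c and C ⊆ R.
  record Slots {n} (h m : ℕ) (A : Subset n) (σ : Permutation′ n) : Set where
    field
      slot       : Fin n → Fin h → Fin m × Subset n
      slot-inj   : ∀ y {i j} → proj₁ (slot y i) ≡ proj₁ (slot y j) → i ≡ j
      slot-∋     : ∀ {y} → y ∈ A → ∀ i → y ∈ proj₂ (slot y i)
      slot-⊆     : ∀ y i → proj₂ (slot y i) ⊆ A
      slot-size  : ∀ y i → ∣ proj₂ (slot y i) ∣ ≤ h
      slot-link  : ∀ y → ∃ λ s → (proj₂ s ⊆ A × ∣ proj₂ s ∣ ≤ h) × ∀ i →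
                   slot (σ ⟨$⟩ʳ y) i ≡ s ⊎ ∃ λ j → slot (σ ⟨$⟩ʳ y) i ≡ slot y j

  -- Slots from coloured orbit segments.

  module _ {n : ℕ} (h′ : ℕ) (A : Subset n) (σ : Permutation′ n) where

    private
      h : ℕ
      h = suc h′

      f g : Fin n → Fin n
      f = σ ⟨$⟩ʳ_
      g = σ ⟨$⟩ˡ_

      fg : ∀ z → f (g z) ≡ z
      fg z = inverseʳ σ

      gf : ∀ z → g (f z) ≡ z
      gf z = inverseˡ σ

      fold-fg : ∀ i z → fold (fold z g i) f i ≡ z
      fold-fg = fold-inverse {f = f} {g} fg

      fold-gf : ∀ i z → fold (fold z f i) g i ≡ z
      fold-gf = fold-inverse {f = g} {f} gf

      -- The points within `h′` steps along the orbit, in both directions to make the relation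
      -- symmetric. On a short orbit `z` is near itself, which is why the colouring only separates
      -- distinct points.
      ahead behind near : Fin n → List (Fin n)
      ahead  z = applyUpTo (λ d → fold z f (suc d)) h′
      behind z = applyUpTo (λ d → fold z g (suc d)) h′
      near   z = ahead z ++ behind z

      near-few : ∀ z → length (near z) < h * h
      near-few z = begin-strict
        length (near z)                          ≡⟨ length-++ (ahead z) ⟩
        length (ahead z) + length (behind z)     ≡⟨ cong₂ _+_ (length-applyUpTo (λ d → fold z f (suc d)) h′)
                                                      (length-applyUpTo (λ d → fold z g (suc d)) h′) ⟩
        h′ + h′                                  <⟨ s≤s (+-monoʳ-≤ h′ (m≤m*n h′ h)) ⟩
        h * h                                    ∎
        where open ≤-Reasoning

      near-sym : ∀ {u v} → u ∈ˡ near v → v ∈ˡ near u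
      near-sym {u} {v} u∈ with ∈-++⁻ (ahead v) u∈
      ... | inj₁ u∈a with d , d< , refl ← ∈-applyUpTo⁻ (λ d → fold v f (suc d)) u∈a =
            ∈-++⁺ʳ (ahead u) (subst (_∈ˡ behind u) (fold-gf (suc d) v)
              (∈-applyUpTo⁺ (λ e → fold u g (suc e)) d<))
      ... | inj₂ u∈b with d , d< , refl ← ∈-applyUpTo⁻ (λ d → fold v g (suc d)) u∈b =
            ∈-++⁺ˡ (subst (_∈ˡ ahead u) (fold-fg (suc d) v)
              (∈-applyUpTo⁺ (λ e → fold u f (suc e)) d<))

      colouring : ∃ λ (col : Fin n → Fin (h * h)) → ∀ {u v} → u ∈ˡ near v → u ≢ v → col u ≢ col v
      colouring = greedy-colouring near near-sym near-few

      col : Fin n → Fin (h * h)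
      col = proj₁ colouring

      iterates : Fin n → Fin h → Fin n
      iterates z i = fold z f (toℕ i)

      segment cluster : Fin n → Subset n
      segment z = select (image? (iterates z))
      cluster z = segment z ∩ A

      fold∈segment : ∀ z {i} → i < h → fold z f i ∈ segment z
      fold∈segment z {i} i<h = ∈-select⁺ (image? (iterates z))
        (fromℕ< i<h , cong (fold z f) (Fin.toℕ-fromℕ< i<h))

      ∈segment⁻ : ∀ {z y} → y ∈ segment z → ∃ λ i → i < h × fold z f i ≡ y
      ∈segment⁻ {z} y∈ = let i , eq = ∈-select⁻ (image? (iterates z)) y∈ in toℕ i , Fin.toℕ<n i , eq

      -- The orbit of `y` has fewer than `h` points: `suc (toℕ d)` runs through the exponents from 1
      -- to `h′`.
      Short : Fin n → Set
      Short y = ∃ λ (d : Fin h′) → fold y f (suc (toℕ d)) ≡ y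

      short? : Decidable Short
      short? y = Fin.any? λ d → fold y f (suc (toℕ d)) Fin.≟ y

      Short-f : ∀ {y} → Short y → Short (f y)
      Short-f {y} (d , eq) = d , trans (fold-shift f y (suc (toℕ d))) (cong f eq)

      Short-f⁻ : ∀ {y} → Short (f y) → Short y
      Short-f⁻ {y} (d , eq) = d ,
        trans (sym (gf _)) (trans (cong g (trans (sym (fold-shift f y (suc (toℕ d)))) eq)) (gf y))

      -- A segment on a short orbit is the entire orbit, so its starting point is immaterial.
      segment-short : ∀ {y} → Short y → segment (f y) ≡ segment y
      segment-short {y} (d , eq) = ⊆-antisym sub sup
        where
        sub : segment (f y) ⊆ segment y
        sub w∈ with i , i<h , refl ← ∈segment⁻ w∈ = subst (_∈ segment y) (sym (fold-shift f y i)) (step i i<h)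
          where
          step : ∀ i → i < h → fold y f (suc i) ∈ segment y
          step i i<h with m≤n⇒m<n∨m≡n i<h
          ... | inj₁ 1+i<h = fold∈segment y 1+i<h
          -- Only the exponent `h` falls out of range; the period `suc (toℕ d)` brings it back to
          -- `h′ ∸ toℕ d`.
          ... | inj₂ refl  = subst (_∈ segment y) wrap (fold∈segment y (s≤s (m∸n≤m h′ (toℕ d))))
            where
            wrap : fold y f (h′ ∸ toℕ d) ≡ fold y f h
            wrap = begin
              fold y f (h′ ∸ toℕ d)                            ≡⟨ cong (λ w → fold w f (h′ ∸ toℕ d)) eq ⟨
              fold (fold y f (suc (toℕ d))) f (h′ ∸ toℕ d)     ≡⟨ fold-+ y f (h′ ∸ toℕ d) ⟨
              fold y f (h′ ∸ toℕ d + suc (toℕ d))              ≡⟨ cong (fold y f) (trans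
                                                                     (+-suc (h′ ∸ toℕ d) (toℕ d)) (cong suc (m∸n+n≡m (<⇒≤ (Fin.toℕ<n d))))) ⟩
              fold y f h                                       ∎
              where open ≡-Reasoning
        sup : segment y ⊆ segment (f y)
        sup w∈ with ∈segment⁻ w∈
        -- The point `y` itself is reached from `f y` by completing the period, in `toℕ d` steps.
        ... | zero  , _   , refl = subst (_∈ segment (f y)) (trans (fold-shift f y (toℕ d)) eq)
                                     (fold∈segment (f y) (<-trans (Fin.toℕ<n d) ≤-refl))
        ... | suc i , i<h , refl = subst (_∈ segment (f y)) (fold-shift f y i)
                                     (fold∈segment (f y) (<-trans ≤-refl i<h))

      -- The two points are `j ∸ i` steps apart, hence near. If they coincided, applying `f` would
      -- return `y` to itself within fewer than `h` steps, making it short.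
      bwd-distinct : ∀ {y} → ¬ Short y → ∀ {i j} → i < j → j < h → col (fold y g j) ≢ col (fold y g i)
      bwd-distinct {y} long {i} {j} i<j j<h = proj₂ colouring near-ji distinct
        where
        e = j ∸ suc i
        j≡ : suc e + i ≡ j
        j≡ = trans (sym (+-suc e i)) (m∸n+n≡m i<j)
        e<h′ : e < h′
        e<h′ = s≤s⁻¹ (≤-<-trans (subst (suc e ≤_) j≡ (m≤m+n (suc e) i)) j<h)
        split : fold y g j ≡ fold (fold y g i) g (suc e)
        split = trans (cong (fold y g) (sym j≡)) (fold-+ y g (suc e))
        near-ji : fold y g j ∈ˡ near (fold y g i)
        near-ji = ∈-++⁺ʳ (ahead (fold y g i)) (subst (_∈ˡ behind (fold y g i)) (sym split) (∈-applyUpTo⁺ (λ d → fold (fold y g i) g (suc d)) e<h′))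
        distinct : fold y g j ≢ fold y g i
        distinct eq = long (fromℕ< e<h′ , (begin
          fold y f (suc (toℕ (fromℕ< e<h′)))          ≡⟨ cong (fold y f ∘ suc) (Fin.toℕ-fromℕ< e<h′) ⟩
          fold y f (suc e)                            ≡⟨ cong (λ w → fold w f (suc e)) (fold-fg i y) ⟨
          fold (fold (fold y g i) f i) f (suc e)      ≡⟨ fold-+ (fold y g i) f (suc e) ⟨
          fold (fold y g i) f (suc e + i)             ≡⟨ cong₂ (λ w → fold w f) (sym eq) j≡ ⟩
          fold (fold y g j) f j                       ≡⟨ fold-fg j y ⟩
          y                                           ∎))
          where open ≡-Reasoning

      -- On a long orbit, slot `i` belongs to the segment starting `i` steps behind `y`. On a short
      -- orbit those starting points repeat and their colours would too, so the first `h` colours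
      -- are used instead, identically for the whole orbit.
      slotFor : (y : Fin n) → Dec (Short y) → Fin h → Fin (h * h) × Subset n
      slotFor y (yes _) i = inject≤ i (m≤m*n h h) , cluster y
      slotFor y (no _)  i = col (fold y g (toℕ i)) , cluster (fold y g (toℕ i))

      slotFor-inj : ∀ y s {i j} → proj₁ (slotFor y s i) ≡ proj₁ (slotFor y s j) → i ≡ j
      slotFor-inj y (yes _)   eq = Fin.inject≤-injective _ _ _ _ eq
      slotFor-inj y (no long) {i} {j} eq with Fin.<-cmp i j
      ... | tri< i<j _ _ = ⊥-elim (bwd-distinct long i<j (Fin.toℕ<n j) (sym eq))
      ... | tri≈ _ i≡j _ = i≡j
      ... | tri> _ _ j<i = ⊥-elim (bwd-distinct long j<i (Fin.toℕ<n i) eq)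

      slotFor-cluster : ∀ y s i → ∃ λ j → j < h × proj₂ (slotFor y s i) ≡ cluster (fold y g j)
      slotFor-cluster y (yes _) i = 0 , s≤s z≤n , refl
      slotFor-cluster y (no _)  i = toℕ i , Fin.toℕ<n i , refl

      slotFor-∋ : ∀ {y} s → y ∈ A → ∀ i → y ∈ proj₂ (slotFor y s i)
      slotFor-∋ {y} s y∈A i with j , j<h , eq ← slotFor-cluster y s i = subst (y ∈_) (sym eq)
        (x∈p∩q⁺ (subst (_∈ segment (fold y g j)) (fold-fg j y) (fold∈segment (fold y g j) j<h) , y∈A))

      cluster-size : ∀ z → ∣ cluster z ∣ ≤ h
      cluster-size z = ≤-trans (∣p∩q∣≤∣p∣ (segment z) A) (image-size (iterates z))

      -- On a long orbit, slot `suc i` of `f y` starts where slot `i` of `y` does, and only slot 0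
      -- is new. On a short orbit all slots agree. Shortness is constant along an orbit, so the
      -- mixed cases are void.
      slotFor-link : ∀ y s s′ i → slotFor (f y) s′ i ≡ (col (f y) , cluster (f y)) ⊎
                                  ∃ λ j → slotFor (f y) s′ i ≡ slotFor y s j
      slotFor-link y (yes s) (yes _)  i       = inj₂ (i , cong (λ c → _ , c ∩ A) (segment-short s))
      slotFor-link y (yes s) (no l)   i       = ⊥-elim (l (Short-f s))
      slotFor-link y (no l)  (yes s)  i       = ⊥-elim (l (Short-f⁻ s))
      slotFor-link y (no _)  (no _)   zero    = inj₁ refl
      slotFor-link y (no _)  (no _)   (suc i) = inj₂ (inject₁ i , cong (λ z → col z , cluster z) (begin
        g (fold (f y) g (toℕ i))       ≡⟨ fold-shift g (f y) (toℕ i) ⟨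
        fold (g (f y)) g (toℕ i)       ≡⟨ cong (λ z → fold z g (toℕ i)) (gf y) ⟩
        fold y g (toℕ i)               ≡⟨ cong (fold y g) (Fin.toℕ-inject₁ i) ⟨
        fold y g (toℕ (inject₁ i))     ∎))
        where open ≡-Reasoning

    slots : Slots h (h * h) A σ
    slots = record
      { slot      = λ y → slotFor y (short? y)
      ; slot-inj  = λ y → slotFor-inj y (short? y)
      ; slot-∋    = λ {y} → slotFor-∋ (short? y)
      ; slot-⊆    = λ y i → let j , _ , eq = slotFor-cluster y (short? y) i in
                    subst (_⊆ A) (sym eq) (p∩q⊆q (segment (fold y g j)) A)
      ; slot-size = λ y i → let j , _ , eq = slotFor-cluster y (short? y) i in
                    subst (λ C → ∣ C ∣ ≤ h) (sym eq) (cluster-size (fold y g j))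
      ; slot-link = λ y → (col (f y) , cluster (f y)) ,
                    (p∩q⊆q (segment (f y)) A , cluster-size (f y)) ,
                    slotFor-link y (short? y) (short? (f y))
      }

open Combinatorics

-- Inequalities, finite sums and indicators in an ordered field.

module OrderedFieldProperties {c ℓ₁ ℓ₂} (F : OrderedField c ℓ₁ ℓ₂) where

  open OrderedField F hiding (zero)
  open CommutativeRing commutativeRing public using (ring; semiring)
  open Algebra.Properties.Ring ring public using (-0#≈0#)
  open Algebra.Properties.Semiring.Exp semiring public using (^-homo-*)
  open Algebra.Properties.Semiring.Mult semiring public using (×1-homo-*)
  module ≈R = Relation.Binary.Reasoning.Setoid setoid

  ≤-reflexive : ∀ {x y} → x ≈ y → x ≤ y
  ≤-reflexive x≈y = <.irrefl (sym x≈y)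

  -- The order is cotransitive because apartness is.
  ≤-trans : ∀ {x y z} → x ≤ y → y ≤ z → x ≤ z
  ≤-trans {x} {y} {z} x≤y y≤z z<x with #-cotrans (Equivalence.from #⇔<⊎> (inj₁ z<x)) y
  ... | inj₁ z#y with Equivalence.to #⇔<⊎> z#y
  ...   | inj₁ z<y = y≤z z<y
  ...   | inj₂ y<z = x≤y (<.trans y<z z<x)
  ≤-trans {x} {y} {z} x≤y y≤z z<x | inj₂ y#x with Equivalence.to #⇔<⊎> y#x
  ...   | inj₁ y<x = x≤y y<x
  ...   | inj₂ x<y = y≤z (<.trans z<x x<y)

  ≤-preorder : Preorder c ℓ₁ ℓ₂
  ≤-preorder = record
    { _≲_ = _≤_
    ; isPreorder = record
      { isEquivalence = CommutativeRing.isEquivalence commutativeRing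
      ; reflexive = ≤-reflexive ; trans = ≤-trans } }

  module ≤R = Relation.Binary.Reasoning.Preorder ≤-preorder

  ≤-refl : ∀ {x} → x ≤ x
  ≤-refl = ≤-reflexive refl

  <⇒≤ : ∀ {x y} → x < y → x ≤ y
  <⇒≤ = <.asym

  -x+[x+y]≈y : ∀ x y → - x + (x + y) ≈ y
  -x+[x+y]≈y x y = trans (sym (+-assoc (- x) x y)) (trans (+-congʳ (-‿inverseˡ x)) (+-identityˡ y))

  x+[y-x]≈y : ∀ x y → x + (y - x) ≈ y
  x+[y-x]≈y x y = begin
    x + (y - x)     ≈⟨ +-congˡ (+-comm y (- x)) ⟩
    x + (- x + y)   ≈⟨ +-assoc x (- x) y ⟨
    x - x + y       ≈⟨ +-congʳ (-‿inverseʳ x) ⟩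
    0# + y          ≈⟨ +-identityˡ y ⟩
    y               ∎
    where open ≈R

  x<y⇒0<y-x : ∀ {x y} → x < y → 0# < y - x
  x<y⇒0<y-x {x} {y} x<y = <.<-respˡ-≈ (-‿inverseˡ x) (<.<-respʳ-≈ (+-comm (- x) y) (+-monoʳ-< (- x) x<y))

  +-monoʳ-≤ : ∀ z {x y} → x ≤ y → z + x ≤ z + y
  +-monoʳ-≤ z {x} {y} x≤y lt =
    x≤y (<.<-respˡ-≈ (-x+[x+y]≈y z y) (<.<-respʳ-≈ (-x+[x+y]≈y z x) (+-monoʳ-< (- z) lt)))

  +-mono-≤ : ∀ {x y u v} → x ≤ y → u ≤ v → x + u ≤ y + v
  +-mono-≤ {x} {y} {u} {v} x≤y u≤v = begin
    x + u   ≲⟨ +-monoʳ-≤ x u≤v ⟩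
    x + v   ≈⟨ +-comm x v ⟩
    v + x   ≲⟨ +-monoʳ-≤ v x≤y ⟩
    v + y   ≈⟨ +-comm v y ⟩
    y + v   ∎
    where open ≤R

  x≤x+y : ∀ {x y} → 0# ≤ y → x ≤ x + y
  x≤x+y {x} {y} 0≤y = ≤-trans (≤-reflexive (sym (+-identityʳ x))) (+-monoʳ-≤ x 0≤y)

  y≤x+y : ∀ {x y} → 0# ≤ x → y ≤ x + y
  y≤x+y {x} {y} 0≤x = ≤-trans (x≤x+y 0≤x) (≤-reflexive (+-comm y x))

  *-monoˡ-< : ∀ {a x y} → 0# < a → x < y → a * x < a * y
  *-monoˡ-< {a} {x} {y} 0<a x<y = <.<-respˡ-≈ (+-identityʳ (a * x)) (<.<-respʳ-≈
    (trans (sym (distribˡ a x (y - x))) (*-congˡ (x+[y-x]≈y x y)))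
    (+-monoʳ-< (a * x) (*-pos 0<a (x<y⇒0<y-x x<y))))

  x-0≈x : ∀ x → x - 0# ≈ x
  x-0≈x x = trans (+-congˡ -0#≈0#) (+-identityʳ x)

  module _ {a} (a#0 : a # 0#) where

    inverse : Carrier
    inverse = proj₁ (#⇒invertible a#0)

    inverse*x≈1 : inverse * a ≈ 1#
    inverse*x≈1 = trans (*-congˡ (sym (x-0≈x a))) (proj₁ (proj₂ (#⇒invertible a#0)))

    inverse#0 : inverse # 0#
    inverse#0 = invertible⇒# (a , trans (*-congˡ (x-0≈x inverse)) (trans (*-comm a inverse) inverse*x≈1) ,
                              trans (*-congʳ (x-0≈x inverse)) inverse*x≈1)

    -- The inverse is apart from 0, hence positive or negative; a negative one would give `1# < 0#`.
    inverse-pos : 0# < a → 0# < inverse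
    inverse-pos 0<a with Equivalence.to #⇔<⊎> inverse#0
    ... | inj₂ 0<b = 0<b
    ... | inj₁ b<0 = ⊥-elim (<.asym 0<1 (<.<-respˡ-≈ (trans (*-comm a inverse) inverse*x≈1)
                       (<.<-respʳ-≈ (zeroʳ a) (*-monoˡ-< 0<a b<0))))

  -- As `≤` is negated `<`, what has to be shown is that `a` cancels from a strict inequality, by
  -- multiplying with its positive inverse.
  *-monoˡ-≤ : ∀ {a x y} → 0# < a → x ≤ y → a * x ≤ a * y
  *-monoˡ-≤ {a} {x} {y} 0<a x≤y lt =
    x≤y (<.<-respˡ-≈ (cancel y) (<.<-respʳ-≈ (cancel x) (*-monoˡ-< (inverse-pos a#0 0<a) lt)))
    where
    a#0 : a # 0#
    a#0 = Equivalence.from #⇔<⊎> (inj₂ 0<a)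
    cancel : ∀ z → inverse a#0 * (a * z) ≈ z
    cancel z = trans (sym (*-assoc _ a z)) (trans (*-congʳ (inverse*x≈1 a#0)) (*-identityˡ z))

  ^-pos : ∀ {x} → 0# < x → ∀ n → 0# < x ^ n
  ^-pos 0<x zero    = 0<1
  ^-pos 0<x (suc n) = *-pos 0<x (^-pos 0<x n)

  fromℕ-suc-* : ∀ n a → fromℕ (suc n) * a ≈ a + fromℕ n * a
  fromℕ-suc-* n a = trans (distribʳ a 1# (fromℕ n)) (+-congʳ (*-identityˡ a))

  fromℕ-*-mono : ∀ {m n a} → 0# ≤ a → m ℕ.≤ n → fromℕ m * a ≤ fromℕ n * a
  fromℕ-*-mono {n = zero}  {a} 0≤a z≤n = ≤-refl
  fromℕ-*-mono {n = suc n} {a} 0≤a z≤n = begin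
    0# * a               ≲⟨ fromℕ-*-mono {n = n} 0≤a z≤n ⟩
    fromℕ n * a          ≲⟨ y≤x+y 0≤a ⟩
    a + fromℕ n * a      ≈⟨ fromℕ-suc-* n a ⟨
    fromℕ (suc n) * a    ∎
    where open ≤R
  fromℕ-*-mono {suc m} {suc n} {a} 0≤a (s≤s m≤n) = begin
    fromℕ (suc m) * a    ≈⟨ fromℕ-suc-* m a ⟩
    a + fromℕ m * a      ≲⟨ +-monoʳ-≤ a (fromℕ-*-mono 0≤a m≤n) ⟩
    a + fromℕ n * a      ≈⟨ fromℕ-suc-* n a ⟨
    fromℕ (suc n) * a    ∎
    where open ≤R

  -- Sums over lists

  module _ {a} {A : Set a} where

    ∑-cong : ∀ xs {f g : A → Carrier} → (∀ x → f x ≈ g x) → ∑ xs f ≈ ∑ xs g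
    ∑-cong []       f≈g = refl
    ∑-cong (x ∷ xs) f≈g = +-cong (f≈g x) (∑-cong xs f≈g)

    ∑-mono : ∀ {xs} {f g : A → Carrier} → All (λ x → f x ≤ g x) xs → ∑ xs f ≤ ∑ xs g
    ∑-mono []           = ≤-refl
    ∑-mono (px ∷ pxs) = +-mono-≤ px (∑-mono pxs)

    ∑-zero : ∀ xs {f : A → Carrier} → (∀ x → f x ≈ 0#) → ∑ xs f ≈ 0#
    ∑-zero []       f≈0 = refl
    ∑-zero (x ∷ xs) f≈0 = trans (+-cong (f≈0 x) (∑-zero xs f≈0)) (+-identityˡ 0#)

    ∑-+ : ∀ xs (f g : A → Carrier) → ∑ xs (λ x → f x + g x) ≈ ∑ xs f + ∑ xs g
    ∑-+ []       f g = sym (+-identityˡ 0#)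
    ∑-+ (x ∷ xs) f g = begin
      f x + g x + ∑ xs (λ x → f x + g x)   ≈⟨ +-congˡ (∑-+ xs f g) ⟩
      f x + g x + (∑ xs f + ∑ xs g)        ≈⟨ +-assoc (f x) (g x) _ ⟩
      f x + (g x + (∑ xs f + ∑ xs g))      ≈⟨ +-congˡ (+-assoc (g x) _ _) ⟨
      f x + (g x + ∑ xs f + ∑ xs g)        ≈⟨ +-congˡ (+-congʳ (+-comm (g x) _)) ⟩
      f x + (∑ xs f + g x + ∑ xs g)        ≈⟨ +-congˡ (+-assoc _ (g x) _) ⟩
      f x + (∑ xs f + (g x + ∑ xs g))      ≈⟨ +-assoc (f x) _ _ ⟨
      f x + ∑ xs f + (g x + ∑ xs g)        ∎
      where open ≈R

    *-distribˡ-∑ : ∀ xs b (f : A → Carrier) → ∑ xs (λ x → b * f x) ≈ b * ∑ xs f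
    *-distribˡ-∑ []       b f = sym (zeroʳ b)
    *-distribˡ-∑ (x ∷ xs) b f = trans (+-congˡ (*-distribˡ-∑ xs b f)) (sym (distribˡ b (f x) _))

    *-distribʳ-∑ : ∀ xs b (f : A → Carrier) → ∑ xs (λ x → f x * b) ≈ ∑ xs f * b
    *-distribʳ-∑ xs b f = trans (∑-cong xs λ x → *-comm (f x) b) (trans (*-distribˡ-∑ xs b f) (*-comm b _))

    ∑-++ : ∀ xs ys (f : A → Carrier) → ∑ (xs ++ ys) f ≈ ∑ xs f + ∑ ys f
    ∑-++ []       ys f = sym (+-identityˡ _)
    ∑-++ (x ∷ xs) ys f = trans (+-congˡ (∑-++ xs ys f)) (sym (+-assoc (f x) _ _))

    ∑-const : ∀ (xs : List A) b → ∑ xs (λ _ → b) ≈ fromℕ (length xs) * b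
    ∑-const []       b = sym (zeroˡ b)
    ∑-const (x ∷ xs) b = trans (+-congˡ (∑-const xs b)) (sym (fromℕ-suc-* (length xs) b))

    ∑-nonneg : ∀ xs {f : A → Carrier} → (∀ x → 0# ≤ f x) → 0# ≤ ∑ xs f
    ∑-nonneg []       0≤f = ≤-refl
    ∑-nonneg (x ∷ xs) 0≤f = ≤-trans (∑-nonneg xs 0≤f) (y≤x+y (0≤f x))

    term≤∑ : ∀ {xs} {f : A → Carrier} → (∀ x → 0# ≤ f x) → ∀ {x} → x ∈ˡ xs → f x ≤ ∑ xs f
    term≤∑ {xs = _ ∷ xs} 0≤f (here ≡.refl) = x≤x+y (∑-nonneg xs 0≤f)
    term≤∑               0≤f (there x∈)    = ≤-trans (term≤∑ 0≤f x∈) (y≤x+y (0≤f _))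

  ∑-map : ∀ {a b} {A : Set a} {B : Set b} (g : A → B) xs (f : B → Carrier) → ∑ (map g xs) f ≡ ∑ xs (f ∘ g)
  ∑-map g xs f = ≡.cong (List.foldr _+_ 0#) (≡.sym (map-∘ xs))

  -- Bridges probability spaces indexed by `Fin` and expectations over a list of outcomes.
  ∑-lookup : ∀ {a} {A : Set a} (xs : List A) (f : A → Carrier) →
             ∑ (allFin (length xs)) (f ∘ List.lookup xs) ≡ ∑ xs f
  ∑-lookup xs f = ≡.trans (≡.sym (∑-map (List.lookup xs) (allFin (length xs)) f))
    (≡.cong (λ ys → ∑ ys f) (≡.trans (map-tabulate id (List.lookup xs)) (tabulate-lookup xs)))

  ∑-cartesianProduct : ∀ {a b} {A : Set a} {B : Set b} (xs : List A) (ys : List B) (f : A × B → Carrier) →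
    ∑ (cartesianProduct xs ys) f ≈ ∑ xs λ x → ∑ ys λ y → f (x , y)
  ∑-cartesianProduct []       ys f = refl
  ∑-cartesianProduct (x ∷ xs) ys f =
    trans (∑-++ (map (x ,_) ys) (cartesianProduct xs ys) f)
          (+-cong (reflexive (∑-map (x ,_) ys f)) (∑-cartesianProduct xs ys f))

  -- Indicators

  ind : Bool → Carrier
  ind b = if b then 1# else 0#

  ind-∧ : ∀ a b → ind (a ∧ b) ≈ ind a * ind b
  ind-∧ true  b = sym (*-identityˡ (ind b))
  ind-∧ false b = sym (zeroˡ (ind b))

  ind-nonneg : ∀ b → 0# ≤ ind b
  ind-nonneg true  = <⇒≤ 0<1
  ind-nonneg false = ≤-refl

  module _ {q} {Q : Set q} (Q? : Dec Q) where

    ind-true : Q → ind (does Q?) ≈ 1#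
    ind-true q = reflexive (≡.cong ind (dec-true Q? q))

    ind-false : ¬ Q → ind (does Q?) ≈ 0#
    ind-false ¬q = reflexive (≡.cong ind (dec-false Q? ¬q))

  ind≤ : ∀ {q} {Q : Set q} (Q? : Dec Q) {b} → 0# ≤ b → (Q → 1# ≤ b) → ind (does Q?) ≤ b
  ind≤ (yes q) 0≤b 1≤b = 1≤b q
  ind≤ (no _)  0≤b 1≤b = 0≤b

  ind-cong : ∀ {q r} {Q : Set q} {R : Set r} (Q? : Dec Q) (R? : Dec R) → (Q → R) → (R → Q) →
             ind (does Q?) ≈ ind (does R?)
  ind-cong Q? R? Q⇒R R⇒Q with R?
  ... | yes r = ind-true Q? (R⇒Q r)
  ... | no ¬r = ind-false Q? (¬r ∘ Q⇒R)

  ∑-allFin-suc : ∀ n (f : Fin (suc n) → Carrier) → ∑ (allFin (suc n)) f ≡ f zero + ∑ (allFin n) (f ∘ suc)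
  ∑-allFin-suc n f = ≡.cong (f zero +_)
    (≡.trans (≡.cong (λ xs → ∑ xs f) (≡.sym (map-tabulate id suc))) (∑-map suc (allFin n) f))

  ∑-point : ∀ {n} (i : Fin n) → ∑ (allFin n) (λ j → ind (does (i Fin.≟ j))) ≈ 1#
  ∑-point {suc n} zero    = trans (reflexive (∑-allFin-suc n _))
    (trans (+-congˡ (∑-zero (allFin n) λ _ → refl)) (+-identityʳ 1#))
  ∑-point {suc n} (suc i) = trans (reflexive (∑-allFin-suc n _)) (trans (+-identityˡ _) (∑-point i))

-- Membership in unions and in element lists.

∈-⋃-map⁻ : ∀ {n a} {I : Set a} (T : I → Subset n) is {x} → x ∈ ⋃ (map T is) → ∃ λ i → i ∈ˡ is × x ∈ T i
∈-⋃-map⁻ T []       x∈ = ⊥-elim (∉⊥ x∈)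
∈-⋃-map⁻ T (i ∷ is) x∈ with x∈p∪q⁻ (T i) (⋃ (map T is)) x∈
... | inj₁ x∈Ti = i , here ≡.refl , x∈Ti
... | inj₂ x∈r  = let j , j∈ , x∈Tj = ∈-⋃-map⁻ T is x∈r in j , there j∈ , x∈Tj

∈-elements⁺ : ∀ {n} {A : Subset n} {y} → y ∈ A → y ∈ˡ elements A
∈-elements⁺ {A = A} {y} = ∈-filter⁺ (_∈? A) (∈-allFin y)

∈-elements⁻ : ∀ {n} {A : Subset n} {y} → y ∈ˡ elements A → y ∈ A
∈-elements⁻ {n} {A} y∈ = proj₂ (∈-filter⁻ (_∈? A) {xs = allFin n} y∈)

-- Probabilities of a random subset and of coin tosses.

module Random {c ℓ₁ ℓ₂} (F : OrderedField c ℓ₁ ℓ₂) (p : OrderedField.Carrier F)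
              (0<p : OrderedField._<_ F (OrderedField.0# F) p) (p<1 : OrderedField._<_ F p (OrderedField.1# F)) where

  open OrderedField F hiding (zero)
  open OrderedFieldProperties F

  p+[1-p]≈1 : p + (1# - p) ≈ 1#
  p+[1-p]≈1 = x+[y-x]≈y p 1#

  0<1-p : 0# < 1# - p
  0<1-p = x<y⇒0<y-x p<1

  subsetProb-pos : ∀ {n} (A R : Subset n) → 0# < subsetProb F p A R
  subsetProb-pos A R = *-pos (^-pos 0<p ∣ R ∣) (^-pos 0<1-p ∣ A ─ R ∣)

  -- The probability that `R` contains `C`, element by element: an element of `C` contributes the
  -- factor `p`, any other element of `A` the factor `p + (1# - p)`.
  Pr-⊆ : ∀ {n} {A C : Subset n} → C ⊆ A →
         ∑ (subsets A) (λ R → subsetProb F p A R * ind (does (C ⊆? R))) ≈ p ^ ∣ C ∣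
  Pr-⊆ {A = Vec.[]} {Vec.[]} _ = trans (+-identityʳ _) (trans (*-identityʳ _) (*-identityʳ 1#))
  Pr-⊆ {A = outside Vec.∷ A} {outside Vec.∷ C} C⊆A =
    trans (reflexive (∑-map (outside Vec.∷_) (subsets A) _)) (Pr-⊆ (drop-∷-⊆ C⊆A))
  Pr-⊆ {A = outside Vec.∷ A} {inside Vec.∷ C} C⊆A with () ← C⊆A Vec.here
  Pr-⊆ {A = inside Vec.∷ A} {s Vec.∷ C} C⊆A = begin
    ∑ (map (inside Vec.∷_) (subsets A) ++ map (outside Vec.∷_) (subsets A)) term
      ≈⟨ ∑-++ (map (inside Vec.∷_) (subsets A)) _ term ⟩
    ∑ (map (inside Vec.∷_) (subsets A)) term + ∑ (map (outside Vec.∷_) (subsets A)) term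
      ≈⟨ +-cong (reflexive (∑-map (inside Vec.∷_) (subsets A) term)) (reflexive (∑-map (outside Vec.∷_) (subsets A) term)) ⟩
    ∑ (subsets A) (λ R → term (inside Vec.∷ R)) + ∑ (subsets A) (λ R → term (outside Vec.∷ R))
      ≈⟨ split s ⟩
    p ^ ∣ s Vec.∷ C ∣ ∎
    where
    open ≈R
    term = λ R → subsetProb F p (inside Vec.∷ A) R * ind (does ((s Vec.∷ C) ⊆? R))
    prob : Subset _ → Carrier
    prob R = subsetProb F p A R
    event : Subset _ → Carrier
    event R = ind (does (C ⊆? R))
    IH : ∑ (subsets A) (λ R → prob R * event R) ≈ p ^ ∣ C ∣
    IH = Pr-⊆ (drop-∷-⊆ C⊆A)
    with-in : ∑ (subsets A) (λ R → p ^ suc ∣ R ∣ * (1# - p) ^ ∣ A ─ R ∣ * event R) ≈ p * p ^ ∣ C ∣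
    with-in = begin
      ∑ (subsets A) (λ R → p ^ suc ∣ R ∣ * (1# - p) ^ ∣ A ─ R ∣ * event R)
        ≈⟨ ∑-cong (subsets A) (λ R → trans (*-congʳ (*-assoc p _ _)) (*-assoc p _ _)) ⟩
      ∑ (subsets A) (λ R → p * (prob R * event R))   ≈⟨ *-distribˡ-∑ (subsets A) p _ ⟩
      p * ∑ (subsets A) (λ R → prob R * event R)     ≈⟨ *-congˡ IH ⟩
      p * p ^ ∣ C ∣                                  ∎
    with-out : ∑ (subsets A) (λ R → p ^ ∣ R ∣ * (1# - p) ^ suc ∣ A ─ R ∣ * event R) ≈ (1# - p) * p ^ ∣ C ∣
    with-out = begin
      ∑ (subsets A) (λ R → p ^ ∣ R ∣ * (1# - p) ^ suc ∣ A ─ R ∣ * event R)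
        ≈⟨ ∑-cong (subsets A) (λ R → trans (*-congʳ (trans (sym (*-assoc _ (1# - p) _))
             (trans (*-congʳ (*-comm _ (1# - p))) (*-assoc (1# - p) _ _)))) (*-assoc (1# - p) _ _)) ⟩
      ∑ (subsets A) (λ R → (1# - p) * (prob R * event R))   ≈⟨ *-distribˡ-∑ (subsets A) (1# - p) _ ⟩
      (1# - p) * ∑ (subsets A) (λ R → prob R * event R)     ≈⟨ *-congˡ IH ⟩
      (1# - p) * p ^ ∣ C ∣                                  ∎
    split : ∀ s → ∑ (subsets A) (λ R → p ^ suc ∣ R ∣ * (1# - p) ^ ∣ A ─ R ∣ * ind (does ((s Vec.∷ C) ⊆? (inside Vec.∷ R))))
          + ∑ (subsets A) (λ R → p ^ ∣ R ∣ * (1# - p) ^ suc ∣ A ─ R ∣ * ind (does ((s Vec.∷ C) ⊆? (outside Vec.∷ R))))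
          ≈ p ^ ∣ s Vec.∷ C ∣
    split outside = begin
      _ + _                                     ≈⟨ +-cong with-in with-out ⟩
      p * p ^ ∣ C ∣ + (1# - p) * p ^ ∣ C ∣      ≈⟨ distribʳ _ p (1# - p) ⟨
      (p + (1# - p)) * p ^ ∣ C ∣                ≈⟨ *-congʳ p+[1-p]≈1 ⟩
      1# * p ^ ∣ C ∣                            ≈⟨ *-identityˡ _ ⟩
      p ^ ∣ C ∣                                 ∎
    split inside = begin
      _ + _                   ≈⟨ +-cong with-in (∑-zero (subsets A) λ R → zeroʳ _) ⟩
      p * p ^ ∣ C ∣ + 0#      ≈⟨ +-identityʳ _ ⟩
      p * p ^ ∣ C ∣           ∎

  -- The distribution of the number of heads before the first tail among h tosses
  -- of a coin with heads probability p.
  levels : ℕ → List (ℕ × Carrier)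
  levels zero    = (0 , 1#) ∷ []
  levels (suc h) = (0 , 1# - p) ∷ map (λ (i , w) → suc i , p * w) (levels h)

  levels-pos : ∀ h → All (λ (_ , w) → 0# < w) (levels h)
  levels-pos zero    = 0<1 ∷ []
  levels-pos (suc h) = 0<1-p ∷ All.map⁺ (All.map (*-pos 0<p) (levels-pos h))

  -- At least `j` initial heads means that the first `j` tosses are heads.
  Pr-level≥ : ∀ {h j} → j ℕ.≤ h → ∑ (levels h) (λ (i , w) → w * ind (does (j ℕ.≤? i))) ≈ p ^ j
  Pr-level≥ {zero} z≤n = trans (+-identityʳ _) (*-identityʳ 1#)
  Pr-level≥ {suc h} {j} j≤h = trans (+-congˡ (reflexive (∑-map _ (levels h) _))) (cases j j≤h)
    where
    open ≈R
    -- After a first head, `j′` more heads are required: the predecessor of `j`, or 0 if `j` is 0.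
    rest : ∀ j j′ → (∀ i → j ℕ.≤ suc i → j′ ℕ.≤ i) → (∀ i → j′ ℕ.≤ i → j ℕ.≤ suc i) → j′ ℕ.≤ h →
           ∑ (levels h) (λ (i , w) → p * w * ind (does (j ℕ.≤? suc i))) ≈ p * p ^ j′
    rest j j′ to from j′≤h = begin
      ∑ (levels h) (λ (i , w) → p * w * ind (does (j ℕ.≤? suc i)))
        ≈⟨ ∑-cong (levels h) (λ (i , w) → trans (*-assoc p w _) (*-congˡ (*-congˡ
             (ind-cong (j ℕ.≤? suc i) (j′ ℕ.≤? i) (to i) (from i))))) ⟩
      ∑ (levels h) (λ (i , w) → p * (w * ind (does (j′ ℕ.≤? i))))   ≈⟨ *-distribˡ-∑ (levels h) p _ ⟩
      p * ∑ (levels h) (λ (i , w) → w * ind (does (j′ ℕ.≤? i)))     ≈⟨ *-congˡ (Pr-level≥ j′≤h) ⟩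
      p * p ^ j′                                                    ∎
    cases : ∀ j → j ℕ.≤ suc h → (1# - p) * ind (does (j ℕ.≤? 0)) +
            ∑ (levels h) (λ (i , w) → p * w * ind (does (j ℕ.≤? suc i))) ≈ p ^ j
    cases zero _ = begin
      _ + _              ≈⟨ +-cong (*-identityʳ (1# - p)) (rest 0 0 (λ _ _ → z≤n) (λ _ _ → z≤n) z≤n) ⟩
      1# - p + p * 1#    ≈⟨ +-congˡ (*-identityʳ p) ⟩
      1# - p + p         ≈⟨ +-comm (1# - p) p ⟩
      p + (1# - p)       ≈⟨ p+[1-p]≈1 ⟩
      1#                 ∎
    cases (suc j) (s≤s j≤h) = begin
      _ + _              ≈⟨ +-cong (zeroʳ (1# - p)) (rest (suc j) j (λ _ → s≤s⁻¹) (λ _ → s≤s) j≤h) ⟩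
      0# + p * p ^ j     ≈⟨ +-identityˡ _ ⟩
      p * p ^ j          ∎

-- The random selection and its probabilities.

module Exchange {c ℓ₁ ℓ₂} (F : OrderedField c ℓ₁ ℓ₂) (p : OrderedField.Carrier F)
                (0<p : OrderedField._<_ F (OrderedField.0# F) p) (p<1 : OrderedField._<_ F p (OrderedField.1# F))
                (h′ : ℕ) {n : ℕ} {A : Subset n} {σ : Permutation′ n}
                (S : Slots (suc h′) (suc h′ ℕ.* suc h′) A σ) where

  open OrderedField F hiding (zero)
  open OrderedFieldProperties F
  open Random F p 0<p p<1
  open Slots S

  private
    h : ℕ
    h = suc h′

  Colour : Set
  Colour = Fin (h ℕ.* h)

  -- `u` is the probability of a single colour, and `α` unfolds to `p ^ h /ℕ h`.
  h⁻¹ u α : Carrier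
  h⁻¹ = proj₁ (#⇒invertible (fromℕ#0 h))
  u   = h⁻¹ * h⁻¹
  α   = p ^ h * h⁻¹

  h⁻¹*h≈1 : h⁻¹ * fromℕ h ≈ 1#
  h⁻¹*h≈1 = inverse*x≈1 (fromℕ#0 h)

  h⁻¹-pos : 0# < h⁻¹
  h⁻¹-pos = inverse-pos (fromℕ#0 h) (0<fromℕ-suc h′)

  h≡1⇒h⁻¹≈1 : h ≡ 1 → h⁻¹ ≈ 1#
  h≡1⇒h⁻¹≈1 h≡1 = begin
    h⁻¹              ≈⟨ *-identityʳ h⁻¹ ⟨
    h⁻¹ * 1#         ≈⟨ *-congˡ (+-identityʳ 1#) ⟨
    h⁻¹ * fromℕ 1    ≈⟨ *-congˡ (reflexive (≡.cong fromℕ h≡1)) ⟨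
    h⁻¹ * fromℕ h    ≈⟨ h⁻¹*h≈1 ⟩
    1#               ∎
    where open ≈R

  α-pos : 0# < α
  α-pos = *-pos (^-pos 0<p h) h⁻¹-pos

  h*u≈h⁻¹ : fromℕ h * u ≈ h⁻¹
  h*u≈h⁻¹ = begin
    fromℕ h * (h⁻¹ * h⁻¹)     ≈⟨ *-assoc (fromℕ h) h⁻¹ h⁻¹ ⟨
    fromℕ h * h⁻¹ * h⁻¹       ≈⟨ *-congʳ (trans (*-comm (fromℕ h) h⁻¹) h⁻¹*h≈1) ⟩
    1# * h⁻¹                  ≈⟨ *-identityˡ h⁻¹ ⟩
    h⁻¹                       ∎
    where open ≈R

  -- A colour, a number of heads, and the probability of that number, carried along so that `weight`
  -- can be read off the outcome.
  Outcome : Set c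
  Outcome = Colour × ℕ × Carrier

  outcomes : List Outcome
  outcomes = cartesianProduct (allFin (h ℕ.* h)) (levels h)

  weight : Outcome → Carrier
  weight (_ , _ , w) = u * w

  -- Strict positivity is the form that `𝔼-mono` passes to `*-monoˡ-≤`.
  weight-pos : All (λ o → 0# < weight o) outcomes
  weight-pos = All.tabulate λ o∈ → *-pos (*-pos h⁻¹-pos h⁻¹-pos)
    (All.lookup (levels-pos h) (proj₂ (∈-cartesianProduct⁻ (allFin (h ℕ.* h)) (levels h) o∈)))

  ∑-weight≈1 : ∑ outcomes weight ≈ 1#
  ∑-weight≈1 = begin
    ∑ outcomes weight
      ≈⟨ ∑-cartesianProduct (allFin (h ℕ.* h)) (levels h) weight ⟩
    ∑ (allFin (h ℕ.* h)) (λ _ → ∑ (levels h) (λ (_ , w) → u * w))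
      ≈⟨ ∑-cong (allFin (h ℕ.* h)) (λ _ → trans (*-distribˡ-∑ (levels h) u proj₂)
           (trans (*-congˡ total-level) (*-identityʳ u))) ⟩
    ∑ (allFin (h ℕ.* h)) (λ _ → u)
      ≈⟨ ∑-const (allFin (h ℕ.* h)) u ⟩
    fromℕ (length (allFin (h ℕ.* h))) * u
      ≈⟨ *-congʳ (reflexive (≡.cong fromℕ (length-tabulate {n = h ℕ.* h} id))) ⟩
    fromℕ (h ℕ.* h) * u
      ≈⟨ *-congʳ (×1-homo-* h h) ⟩
    fromℕ h * fromℕ h * u
      ≈⟨ *-assoc (fromℕ h) (fromℕ h) u ⟩
    fromℕ h * (fromℕ h * u)
      ≈⟨ *-congˡ h*u≈h⁻¹ ⟩
    fromℕ h * h⁻¹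
      ≈⟨ trans (*-comm (fromℕ h) h⁻¹) h⁻¹*h≈1 ⟩
    1# ∎
    where
    open ≈R
    total-level : ∑ (levels h) proj₂ ≈ 1#
    -- The total weight is the probability of at least 0 heads.
    total-level = trans (∑-cong (levels h) λ (_ , w) → sym (*-identityʳ w)) (Pr-level≥ {h} {0} z≤n)

  space : FiniteProbabilitySpace F
  space = record
    { size     = length outcomes
    ; prob     = weight ∘ List.lookup outcomes
    ; prob≥0   = λ ω → <⇒≤ (All.lookup weight-pos (∈-lookup ω))
    ; ∑-prob≈1 = trans (reflexive (∑-lookup outcomes weight)) ∑-weight≈1
    }

  𝔼 : (Outcome → Subset n → Carrier) → Carrier
  𝔼 f = ∑ outcomes λ o → ∑ (subsets A) λ R → weight o * subsetProb F p A R * f o R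

  𝔼-mono : ∀ {f g} → (∀ o R → f o R ≤ g o R) → 𝔼 f ≤ 𝔼 g
  𝔼-mono f≤g = ∑-mono (All.map (λ {o} 0<w → ∑-mono {xs = subsets A} (All.tabulate λ {R} _ →
    *-monoˡ-≤ (*-pos 0<w (subsetProb-pos A R)) (f≤g o R))) weight-pos)

  𝔼-cong : ∀ {f g} → (∀ o R → f o R ≈ g o R) → 𝔼 f ≈ 𝔼 g
  𝔼-cong f≈g = ∑-cong outcomes λ o → ∑-cong (subsets A) λ R → *-congˡ (f≈g o R)

  𝔼-+ : ∀ f g → 𝔼 (λ o R → f o R + g o R) ≈ 𝔼 f + 𝔼 g
  𝔼-+ f g = trans (∑-cong outcomes λ o → trans (∑-cong (subsets A) λ R → distribˡ _ (f o R) (g o R))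
    (∑-+ (subsets A) _ _)) (∑-+ outcomes _ _)

  𝔼-∑ : ∀ {a} {I : Set a} (is : List I) (f : I → Outcome → Subset n → Carrier) →
        𝔼 (λ o R → ∑ is λ i → f i o R) ≈ ∑ is λ i → 𝔼 (f i)
  𝔼-∑ []       f = ∑-zero outcomes λ o → ∑-zero (subsets A) λ R → zeroʳ _
  𝔼-∑ (i ∷ is) f = trans (𝔼-+ (f i) λ o R → ∑ is λ j → f j o R) (+-congˡ (𝔼-∑ is f))

  -- The threshold on the number of heads compensates for sets `C` with fewer than `h` elements.
  Occurs : Colour × Subset n → Outcome → Subset n → Set
  Occurs (d , C) (c , i , _) R = d ≡ c × h ℕ.∸ ∣ C ∣ ℕ.≤ i × C ⊆ R

  occurs? : ∀ s o R → Dec (Occurs s o R)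
  occurs? (d , C) (c , i , _) R = (d Fin.≟ c) ×-dec (h ℕ.∸ ∣ C ∣ ℕ.≤? i) ×-dec (C ⊆? R)

  -- The three conditions are independent, with probabilities `u`, `p ^ (h ∸ ∣ C ∣)` and
  -- `p ^ ∣ C ∣`; their product does not depend on `C`.
  Pr-occurs : ∀ s → proj₂ s ⊆ A → ∣ proj₂ s ∣ ℕ.≤ h →
              𝔼 (λ o R → ind (does (occurs? s o R))) ≈ h⁻¹ * α
  Pr-occurs (d , C) C⊆A ∣C∣≤h = begin
    𝔼 (λ o R → ind (does (occurs? (d , C) o R)))
      ≈⟨ ∑-cong outcomes (λ o → trans (∑-cong (subsets A) (factor o)) (inner o)) ⟩
    ∑ outcomes (λ (c , i , w) → same c * (u * p ^ ∣ C ∣ * (w * high i)))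
      ≈⟨ ∑-cartesianProduct (allFin (h ℕ.* h)) (levels h) _ ⟩
    ∑ (allFin (h ℕ.* h)) (λ c → ∑ (levels h) (λ (i , w) → same c * (u * p ^ ∣ C ∣ * (w * high i))))
      ≈⟨ ∑-cong (allFin (h ℕ.* h)) (λ c → trans (*-distribˡ-∑ (levels h) (same c) _)
           (*-congˡ (trans (*-distribˡ-∑ (levels h) (u * p ^ ∣ C ∣) _) (*-congˡ (Pr-level≥ (ℕ.m∸n≤m h ∣ C ∣)))))) ⟩
    ∑ (allFin (h ℕ.* h)) (λ c → same c * (u * p ^ ∣ C ∣ * p ^ (h ℕ.∸ ∣ C ∣)))
      ≈⟨ *-distribʳ-∑ (allFin (h ℕ.* h)) _ same ⟩
    ∑ (allFin (h ℕ.* h)) same * (u * p ^ ∣ C ∣ * p ^ (h ℕ.∸ ∣ C ∣))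
      ≈⟨ trans (*-congʳ (∑-point d)) (*-identityˡ _) ⟩
    u * p ^ ∣ C ∣ * p ^ (h ℕ.∸ ∣ C ∣)
      ≈⟨ trans (*-assoc u _ _) (*-congˡ (sym (^-homo-* p ∣ C ∣ (h ℕ.∸ ∣ C ∣)))) ⟩
    u * p ^ (∣ C ∣ ℕ.+ (h ℕ.∸ ∣ C ∣))
      ≈⟨ *-congˡ (reflexive (≡.cong (p ^_) (ℕ.m+[n∸m]≡n ∣C∣≤h))) ⟩
    h⁻¹ * h⁻¹ * p ^ h
      ≈⟨ trans (*-assoc h⁻¹ h⁻¹ _) (*-congˡ (*-comm h⁻¹ _)) ⟩
    h⁻¹ * α ∎
    where
    open ≈R
    same : Colour → Carrier
    same c = ind (does (d Fin.≟ c))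
    high : ℕ → Carrier
    high i = ind (does (h ℕ.∸ ∣ C ∣ ℕ.≤? i))
    sub : Subset n → Carrier
    sub R = ind (does (C ⊆? R))
    factor : ∀ o R → weight o * subsetProb F p A R * ind (does (occurs? (d , C) o R)) ≈
      (same (proj₁ o) * (u * (proj₂ (proj₂ o) * high (proj₁ (proj₂ o))))) * (subsetProb F p A R * sub R)
    factor (c , i , w) R = begin
      u * w * q * ind (does (d Fin.≟ c) ∧ does (h ℕ.∸ ∣ C ∣ ℕ.≤? i) ∧ does (C ⊆? R))
        ≈⟨ *-congˡ (trans (ind-∧ _ _) (*-congˡ (ind-∧ _ _))) ⟩
      u * w * q * (same c * (high i * sub R))   ≈⟨ rearrange u w q (same c) (high i) (sub R) ⟩
      (same c * (u * (w * high i))) * (q * sub R) ∎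
      where
      open Algebra.Solver.CommutativeMonoid (CommutativeRing.*-commutativeMonoid commutativeRing)
      q = subsetProb F p A R
      rearrange : ∀ a b c d e f → a * b * c * (d * (e * f)) ≈ (d * (a * (b * e))) * (c * f)
      rearrange = solve 6 (λ a b c d e f → ((a ⊕ b) ⊕ c) ⊕ (d ⊕ (e ⊕ f)) ⊜ (d ⊕ (a ⊕ (b ⊕ e))) ⊕ (c ⊕ f)) refl
    inner : ∀ o → ∑ (subsets A) (λ R → (same (proj₁ o) * (u * (proj₂ (proj₂ o) * high (proj₁ (proj₂ o))))) *
                   (subsetProb F p A R * sub R)) ≈
                  same (proj₁ o) * (u * p ^ ∣ C ∣ * (proj₂ (proj₂ o) * high (proj₁ (proj₂ o))))
    inner (c , i , w) = begin
      ∑ (subsets A) (λ R → (same c * (u * (w * high i))) * (subsetProb F p A R * sub R))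
        ≈⟨ *-distribˡ-∑ (subsets A) (same c * (u * (w * high i))) _ ⟩
      (same c * (u * (w * high i))) * ∑ (subsets A) (λ R → subsetProb F p A R * sub R)
        ≈⟨ *-congˡ (Pr-⊆ C⊆A) ⟩
      (same c * (u * (w * high i))) * p ^ ∣ C ∣
        ≈⟨ *-assoc (same c) _ _ ⟩
      same c * (u * (w * high i) * p ^ ∣ C ∣)
        ≈⟨ *-congˡ (trans (*-assoc u _ _) (trans (*-congˡ (*-comm (w * high i) _)) (sym (*-assoc u _ _)))) ⟩
      same c * (u * p ^ ∣ C ∣ * (w * high i)) ∎

  -- Since `σ` acts on the whole ground set, elements outside `A` have slots as well; the condition
  -- `y ∈ A` keeps them out of the selection.
  Chosen : Outcome → Subset n → Fin n → Set
  Chosen o R y = (y ∈ R × y ∈ A) × ∃ λ i → Occurs (slot y i) o R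

  chosen? : ∀ o R → Decidable (Chosen o R)
  chosen? o R y = ((y ∈? R) ×-dec (y ∈? A)) ×-dec Fin.any? λ i → occurs? (slot y i) o R

  selected : Outcome → Subset n → Subset n
  selected o R = select (chosen? o R)

  selected⊆A : ∀ {o R} → selected o R ⊆ A
  selected⊆A {o} {R} y∈ = proj₂ (proj₁ (∈-select⁻ (chosen? o R) y∈))

  selected⊆R : ∀ {o R} → selected o R ⊆ R
  selected⊆R {o} {R} y∈ = proj₁ (proj₁ (∈-select⁻ (chosen? o R) y∈))

  occurs⇒∈selected : ∀ {y} → y ∈ A → ∀ i {o R} → Occurs (slot y i) o R → y ∈ selected o R
  occurs⇒∈selected y∈A i {o} {R} occ@(_ , _ , C⊆R) = ∈-select⁺ (chosen? o R) ((C⊆R (slot-∋ y∈A i) , y∈A) , i , occ)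

  -- The slots of `y` have distinct colours, so at most one of them occurs and the union of their
  -- events is an exact sum. Hence `Pr-selected` is an equality.
  ind-selected : ∀ {y} → y ∈ A → ∀ o R →
           ind (does (y ∈? selected o R)) ≈ ∑ (allFin h) λ i → ind (does (occurs? (slot y i) o R))
  ind-selected {y} y∈A o R with Fin.any? (λ i → occurs? (slot y i) o R)
  ... | no none = trans
        (ind-false (y ∈? selected o R) λ y∈ → none (proj₂ (∈-select⁻ (chosen? o R) y∈)))
        (sym (∑-zero (allFin h) λ i → ind-false (occurs? (slot y i) o R) λ occ → none (i , occ)))
  ... | yes (i , occ) = trans (ind-true (y ∈? selected o R) (occurs⇒∈selected y∈A i {o} {R} occ))
        (sym (trans (∑-cong (allFin h) λ j → ind-cong (occurs? (slot y j) o R) (i Fin.≟ j)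
          (λ occ′ → slot-inj y (≡.trans (proj₁ occ) (≡.sym (proj₁ occ′))))
          (λ { ≡.refl → occ })) (∑-point i)))

  Pr-selected : ∀ {y} → y ∈ A → 𝔼 (λ o R → ind (does (y ∈? selected o R))) ≈ α
  Pr-selected {y} y∈A = begin
    𝔼 (λ o R → ind (does (y ∈? selected o R)))
      ≈⟨ 𝔼-cong (ind-selected y∈A) ⟩
    𝔼 (λ o R → ∑ (allFin h) λ i → ind (does (occurs? (slot y i) o R)))
      ≈⟨ 𝔼-∑ (allFin h) (λ i o R → ind (does (occurs? (slot y i) o R))) ⟩
    ∑ (allFin h) (λ i → 𝔼 (λ o R → ind (does (occurs? (slot y i) o R))))
      ≈⟨ ∑-cong (allFin h) (λ i → Pr-occurs (slot y i) (slot-⊆ y i) (slot-size y i)) ⟩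
    ∑ (allFin h) (λ _ → h⁻¹ * α)
      ≈⟨ ∑-const (allFin h) (h⁻¹ * α) ⟩
    fromℕ (length (allFin h)) * (h⁻¹ * α)
      ≈⟨ *-congʳ (reflexive (≡.cong fromℕ (length-tabulate {n = h} id))) ⟩
    fromℕ h * (h⁻¹ * α)
      ≈⟨ *-assoc (fromℕ h) h⁻¹ α ⟨
    fromℕ h * h⁻¹ * α
      ≈⟨ *-congʳ (trans (*-comm (fromℕ h) h⁻¹) h⁻¹*h≈1) ⟩
    1# * α
      ≈⟨ *-identityˡ α ⟩
    α ∎
    where open ≈R

  module _ (T : Fin n → Subset n) where

    removed : Outcome → Subset n → Subset n
    removed o R = ⋃ (map T (elements (selected o R)))

    owners : Fin n → List (Fin n)
    owners x = filter (λ y → x ∈? T y) (elements A)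

    ∈-removed⁻ : ∀ {x o R} → x ∈ removed o R → ∃ λ y → y ∈ˡ owners x × y ∈ selected o R
    ∈-removed⁻ {x} {o} {R} x∈ with y , y∈ , x∈Ty ← ∈-⋃-map⁻ T (elements (selected o R)) x∈ =
      let y∈selected = ∈-elements⁻ {A = selected o R} y∈
      in y , ∈-filter⁺ (λ y → x ∈? T y) (∈-elements⁺ {A = A} (selected⊆A {o} {R} y∈selected)) x∈Ty , y∈selected

    ∈-owners⁻ : ∀ {x y} → y ∈ˡ owners x → y ∈ A
    ∈-owners⁻ {x} y∈ = ∈-elements⁻ {A = A} (proj₁ (∈-filter⁻ (λ y → x ∈? T y) {xs = elements A} y∈))

    chosen : Fin n → Outcome → Subset n → Carrier
    chosen y o R = ind (does (y ∈? selected o R))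

    1≤∑-chosen : ∀ {ys y o R} → y ∈ˡ ys → y ∈ selected o R → 1# ≤ ∑ ys λ y → chosen y o R
    1≤∑-chosen {ys} {y} {o} {R} y∈ y∈selected =
      ≤-trans (≤-reflexive (sym (ind-true (y ∈? selected o R) y∈selected)))
              (term≤∑ (λ z → ind-nonneg (does (z ∈? selected o R))) y∈)

    𝔼-∑-chosen : ∀ ys → (∀ {y} → y ∈ˡ ys → y ∈ A) →
                 𝔼 (λ o R → ∑ ys λ y → chosen y o R) ≤ fromℕ (length ys) * α
    𝔼-∑-chosen ys ys⊆A = begin
      𝔼 (λ o R → ∑ ys λ y → chosen y o R)   ≈⟨ 𝔼-∑ ys chosen ⟩
      ∑ ys (λ y → 𝔼 (chosen y))             ≲⟨ ∑-mono (All.tabulate λ y∈ → ≤-reflexive (Pr-selected (ys⊆A y∈))) ⟩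
      ∑ ys (λ _ → α)                        ≈⟨ ∑-const ys α ⟩
      fromℕ (length ys) * α                 ∎
      where open ≤R

    -- Union bound: `x` is removed only if one of its owners is selected.
    Pr-removed≤owners : ∀ x → 𝔼 (λ o R → ind (does (x ∈? removed o R))) ≤ fromℕ (length (owners x)) * α
    Pr-removed≤owners x = ≤-trans (𝔼-mono pointwise) (𝔼-∑-chosen (owners x) ∈-owners⁻)
      where
      pointwise : ∀ o R → ind (does (x ∈? removed o R)) ≤ ∑ (owners x) λ y → chosen y o R
      pointwise o R = ind≤ (x ∈? removed o R) (∑-nonneg (owners x) λ z → ind-nonneg (does (z ∈? selected o R)))
        λ x∈ → let y , y∈ , y∈selected = ∈-removed⁻ {x} {o} {R} x∈ in 1≤∑-chosen {o = o} {R} y∈ y∈selected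

    -- If σ y is chosen then so is y, unless the one slot that σ y does not share with y occurs.
    Pr-removed≤linked : ∀ {x y} → y ∈ˡ owners x → σ ⟨$⟩ʳ y ∈ˡ owners x → y ≢ σ ⟨$⟩ʳ y →
                   𝔼 (λ o R → ind (does (x ∈? removed o R))) ≤ fromℕ (ℕ.pred (length (owners x))) * α + h⁻¹ * α
    Pr-removed≤linked {x} {y} y∈ y′∈ y≢y′ = begin
      𝔼 (λ o R → ind (does (x ∈? removed o R)))
        ≲⟨ 𝔼-mono pointwise ⟩
      𝔼 (λ o R → ∑ others (λ z → chosen z o R) + ind (does (occurs? s o R)))
        ≈⟨ 𝔼-+ _ _ ⟩
      𝔼 (λ o R → ∑ others (λ z → chosen z o R)) + 𝔼 (λ o R → ind (does (occurs? s o R)))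
        ≲⟨ +-mono-≤ (𝔼-∑-chosen others (∈-owners⁻ ∘ others⊆))
                    (≤-reflexive (Pr-occurs s (proj₁ s-ok) (proj₂ s-ok))) ⟩
      fromℕ (length others) * α + h⁻¹ * α
        -- The list `others` lacks `y′`, so it is strictly shorter than `owners x`.
        ≲⟨ +-mono-≤ (fromℕ-*-mono (<⇒≤ α-pos) (ℕ.suc[m]≤n⇒m≤pred[n]
             (filter-notAll other? (owners x) (lose y′∈ λ ne → ne ≡.refl)))) ≤-refl ⟩
      fromℕ (ℕ.pred (length (owners x))) * α + h⁻¹ * α ∎
      where
      open ≤R
      y′ = σ ⟨$⟩ʳ y
      s = proj₁ (slot-link y)
      s-ok = proj₁ (proj₂ (slot-link y))
      link = proj₂ (proj₂ (slot-link y))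
      other? : Decidable (_≢ y′)
      other? z = ¬? (z Fin.≟ y′)
      others = filter other? (owners x)
      others⊆ : ∀ {z} → z ∈ˡ others → z ∈ˡ owners x
      others⊆ z∈ = proj₁ (∈-filter⁻ other? {xs = owners x} z∈)
      pointwise : ∀ o R → ind (does (x ∈? removed o R)) ≤
                          ∑ others (λ z → chosen z o R) + ind (does (occurs? s o R))
      pointwise o R = ind≤ (x ∈? removed o R) (≤-trans ∑≥0 (x≤x+y s≥0)) covered
        where
        ∑≥0 = ∑-nonneg others λ z → ind-nonneg (does (z ∈? selected o R))
        s≥0 = ind-nonneg (does (occurs? s o R))
        covered-by : ∀ {z} → z ∈ˡ owners x → z ≢ y′ → z ∈ selected o R →
                     1# ≤ ∑ others (λ z → chosen z o R) + ind (does (occurs? s o R))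
        covered-by z∈ z≢y′ z∈selected =
          ≤-trans (1≤∑-chosen {o = o} {R} (∈-filter⁺ other? z∈ z≢y′) z∈selected) (x≤x+y s≥0)
        covered : x ∈ removed o R → 1# ≤ ∑ others (λ z → chosen z o R) + ind (does (occurs? s o R))
        covered x∈ with ∈-removed⁻ {x} {o} {R} x∈
        ... | z , z∈ , z∈selected with z Fin.≟ y′
        ...   | no z≢y′ = covered-by z∈ z≢y′ z∈selected
        -- The owner found is `y′`, selected through slot `i`. Either this is the unshared slot `s`,
        -- or `y` has the same slot, so `y` is selected too, and it is still listed in `others`.
        ...   | yes ≡.refl with ∈-select⁻ (chosen? o R) z∈selected
        ...     | _ , i , occ with link i
        ...       | inj₁ eq = ≤-trans (≤-reflexive (sym (ind-true (occurs? s o R)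
                      (≡.subst (λ t → Occurs t o R) eq occ)))) (y≤x+y ∑≥0)
        ...       | inj₂ (j , eq) = covered-by y∈ y≢y′
                      (occurs⇒∈selected (∈-owners⁻ y∈) j {o} {R} (≡.subst (λ t → Occurs t o R) eq occ))

-- Assembling the uniform exchange map.

module UniformMap {c ℓ₁ ℓ₂ ℓ} (F : OrderedField c ℓ₁ ℓ₂) (p : OrderedField.Carrier F)
  (0<p : OrderedField._<_ F (OrderedField.0# F) p) (p<1 : OrderedField._<_ F p (OrderedField.1# F))
  (k′ h′ : ℕ) {n : ℕ} {D : Pred (Subset n) ℓ} {X Y : Subset n}
  (family : ExchangeFamily (suc k′) D X Y) where

  open OrderedField F hiding (zero)
  open OrderedFieldProperties F
  open ExchangeFamily family

  private
    k h : ℕ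
    k = suc k′
    h = suc h′

    A B : Subset n
    A = Y ─ X
    B = X ─ Y

    disjoint : ∀ {v} → v ∈ A → v ∉ B
    disjoint v∈A v∈B = x∈p─q⇒x∉q Y X v∈A (p─q⊆p X Y v∈B)

    β : Carrier
    β = p ^ h /ℕ h * ((fromℕ k - 1#) + 1# /ℕ h)

  module _ (σ : Permutation′ n) where

    open Exchange F p 0<p p<1 h′ (slots h′ A σ)

    β≈ : β ≈ fromℕ k′ * α + h⁻¹ * α
    β≈ = begin
      α * ((fromℕ k - 1#) + 1# * h⁻¹)   ≈⟨ *-congˡ (+-cong (trans (+-comm (fromℕ k) (- 1#))
                                             (-x+[x+y]≈y 1# (fromℕ k′))) (*-identityˡ h⁻¹)) ⟩
      α * (fromℕ k′ + h⁻¹)              ≈⟨ *-comm α _ ⟩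
      (fromℕ k′ + h⁻¹) * α              ≈⟨ distribʳ α (fromℕ k′) h⁻¹ ⟩
      fromℕ k′ * α + h⁻¹ * α            ∎
      where open ≈R

    -- `removed T` is exactly the union occurring in `exchange`, so feasibility is the exchange
    -- property applied to the selected set.
    exchangeMap : ExchangeMap F D X Y
    exchangeMap = record
      { space    = space
      ; S        = selected ∘ List.lookup outcomes
      ; T        = removed T ∘ List.lookup outcomes
      ; S⊆R      = λ ω {R} _ → selected⊆R {List.lookup outcomes ω} {R}
      ; T⊆X─Y    = λ ω {R} _ {x} x∈ →
                   let y , y∈ , _ = ∈-removed⁻ T {x} {List.lookup outcomes ω} {R} x∈
                   in T⊆X─Y (∈-owners⁻ T y∈) (proj₂ (∈-filter⁻ (λ y → x ∈? T y) {xs = elements A} y∈))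
      ; feasible = λ ω {R} _ → exchange (selected (List.lookup outcomes ω) R)
                   (selected⊆A {List.lookup outcomes ω} {R})
      }

    Pr∈≡𝔼 : ∀ (M : Outcome → Subset n → Subset n) z →
            Pr∈ F space p A (M ∘ List.lookup outcomes) z ≡ 𝔼 (λ o R → ind (does (z ∈? M o R)))
    Pr∈≡𝔼 M z = ∑-lookup outcomes λ o → ∑ (subsets A) λ R →
      weight o * subsetProb F p A R * ind (does (z ∈? M o R))

    -- An `x` with at most `k′` owners is settled by the union bound, which gives `fromℕ k′ * α`; so
    -- the bound is assumed only for `k` owners.
    uniform : (∀ {x} → x ∈ B → length (owners T x) ≡ k →
               𝔼 (λ o R → ind (does (x ∈? removed T o R))) ≤ fromℕ k′ * α + h⁻¹ * α) →
              IsUniform F p (p ^ h /ℕ h) β exchangeMap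
    uniform full = record
      { Pr∈S≥α = λ {y} y∈A → ≤-reflexive (sym (trans (reflexive (Pr∈≡𝔼 selected y)) (Pr-selected y∈A)))
      ; Pr∈T≤β = λ {x} x∈B → ≤-trans (≤-reflexive (reflexive (Pr∈≡𝔼 (removed T) x)))
                   (≤-trans (bound x∈B) (≤-reflexive (sym β≈)))
      }
      where
      bound : ∀ {x} → x ∈ B → 𝔼 (λ o R → ind (does (x ∈? removed T o R))) ≤ fromℕ k′ * α + h⁻¹ * α
      bound {x} x∈B with ℕ.m≤n⇒m<n∨m≡n (occurrence≤k x∈B)
      ... | inj₁ less = ≤-trans (Pr-removed≤owners T x) (≤-trans (fromℕ-*-mono (<⇒≤ α-pos) (s≤s⁻¹ less))
                          (x≤x+y (<⇒≤ (*-pos h⁻¹-pos α-pos))))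
      ... | inj₂ eq   = full x∈B eq

  admits : (k ≡ 1 → h ≡ 1) → Σ (ExchangeMap F D X Y) (IsUniform F p (p ^ h /ℕ h) β)
  admits k≡1⇒h≡1 with k′ ℕ.≟ 0
  -- For `k = 1` also `h = 1`, so `β` equals `α` and the union bound over the single owner suffices,
  -- whatever the permutation.
  ... | yes ≡.refl = exchangeMap idₚ , uniform idₚ λ {x} _ eq →
        ≤-trans (Pr-removed≤owners T x) (≤-reflexive (begin
          fromℕ (length (owners T x)) * α     ≈⟨ *-congʳ (reflexive (≡.cong fromℕ eq)) ⟩
          fromℕ 1 * α                         ≈⟨ *-congʳ (+-identityʳ 1#) ⟩
          1# * α                              ≈⟨ *-congʳ (h≡1⇒h⁻¹≈1 (k≡1⇒h≡1 ≡.refl)) ⟨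
          h⁻¹ * α                             ≈⟨ +-identityˡ _ ⟨
          0# + h⁻¹ * α                        ≈⟨ +-congʳ (zeroˡ α) ⟨
          fromℕ 0 * α + h⁻¹ * α               ∎))
    where
    open Exchange F p 0<p p<1 h′ (slots h′ A idₚ)
    open ≈R
  ... | no k′≢0 =
    let σ , linked = linking (s≤s (ℕ.n≢0⇒n>0 k′≢0))
    in exchangeMap σ , uniform σ λ {x} x∈B full → linkedBound σ linked x∈B full
    where
    open Linking A B T disjoint T⊆X─Y size≤k occurrence≤k
    linkedBound : ∀ σ → Linked σ → ∀ {x} → x ∈ B → length (filter (λ y → x ∈? T y) (elements A)) ≡ k →
      let open Exchange F p 0<p p<1 h′ (slots h′ A σ) in
      𝔼 (λ o R → ind (does (x ∈? removed T o R))) ≤ fromℕ k′ * α + h⁻¹ * α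
    linkedBound σ linked {x} x∈B full =
      let y , (y∈A , x∈Ty) , (y′∈A , x∈Ty′) , y≢y′ = linked x∈B full
      in ≡.subst (λ l → 𝔼 (λ o R → ind (does (x ∈? removed T o R))) ≤ fromℕ (ℕ.pred l) * α + h⁻¹ * α) full
           (Pr-removed≤linked T (∈-filter⁺ (λ y → x ∈? T y) (∈-elements⁺ {A = A} y∈A) x∈Ty)
             (∈-filter⁺ (λ y → x ∈? T y) (∈-elements⁺ {A = A} y′∈A) x∈Ty′) y≢y′)
      where open Exchange F p 0<p p<1 h′ (slots h′ A σ)

-- The condition on `k ≡ 1` excludes a genuine failure. Let `D` consist of the sets of size at most
-- 1 on two elements x and y, which is a 1-exchange system, and let `X` be the singleton of x and
-- `Y` that of y. Selecting y forces the removal of x, so a uniform map would give `α ≤ β`, whereas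
-- `β` is `α` divided by `h`.
lemma4p1 : ∀ {c ℓ₁ ℓ₂ ℓ} (F : OrderedField c ℓ₁ ℓ₂) → let open OrderedField F in
    (n : ℕ) (p : Carrier) → 0# < p → p < 1# →
    (k : ℕ) .{{_ : NonZero k}} (h : ℕ) .{{_ : NonZero h}} → (k ≡ 1 → h ≡ 1) →
    (D : Pred (Subset n) ℓ) → IsExchangeSystem k D →
    let α = p ^ h /ℕ h
        β = p ^ h /ℕ h * ((fromℕ k - 1#) + 1# /ℕ h)
    in AdmitsUniformExchangeMap F p α β D
lemma4p1 F n p 0<p p<1 (suc k′) (suc h′) k≡1⇒h≡1 D system DX DY =
  UniformMap.admits F p 0<p p<1 k′ h′ (IsExchangeSystem.exchangeFamily system DX DY) k≡1⇒h≡1
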